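{- Let $a,b,c\geq 4$ be integers and let $FCS_{a,b,c}$ be the zigzag-edge coronoid fused with starphene (defined in the context). Then the metric dimension of $FCS_{a,b,c}$ is $3$, i.e. $\dim(FCS_{a,b,c})=3$.
   Context: All graphs are finite, simple, connected and undirected; $d(x,y)$ denotes the shortest-path distance between vertices $x,y$. Metric dimension: a vertex $\alpha$ resolves two distinct vertices $\beta,\gamma$ if $d(\alpha,\beta)\neq d(\alpha,\gamma)$. A set $U\subseteq V(\Gamma)$ is a metric generator (resolving set) of $\Gamma$ if every pair of distinct vertices of $\Gamma$ is resolved by some element of $U$. The metric dimension $\dim(\Gamma)$ is the minimum cardinality of a metric generator of $\Gamma$. The graph $FCS_{a,b,c}$ (a benzenoid/hexagonal system, regarded as a graph whose vertices are the atoms and whose edges are the bonds): take the zigzag-edge (hollow) coronoid $HC_{a,b,c}$, the benzenoid obtained by fusing six linear polyacene chains containing $a,b,c,a,b,c$ hexagons respectively into a closed loop, consecutive chains sharing their terminal (corner) hexagon, so that the structure has a central hole. Inside the hole place a starphene: a central hexagon from which three linear polyacene arms emanate, containing $a-2$, $b-2$ and $c-2$ hexagons respectively (not counting the central hexagon), the arm with $a-2$ hexagons running parallel to the chains of $a$ hexagons (and similarly for $b$, $c$); the terminal hexagon of each arm lies in a corner of the hole and is fused to the coronoid by sharing three consecutive edges of the hole boundary with it. The resulting graph $FCS_{a,b,c}$ has $6(2a+2b+2c-9)$ vertices ($6(a+b+c-6)$ of degree $2$ and $6(a+b+c-3)$ of degree $3$), $3(5a+5b+5c-21)$ edges, and $3a+3b+3c-11$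 hexagonal faces. -}

module Defs where

open import Data.Nat using (ℕ; zero; suc; _+_; _∸_; _≤_; _≤ᵇ_; _≡ᵇ_)
open import Data.Bool using (Bool; true; false; _∧_; _∨_; T)
open import Data.Product using (Σ; _×_; _,_; ∃; ∃-syntax)
open import Data.List using (List; length)
open import Data.List.Membership.Propositional using (_∈_)
open import Data.List.Relation.Unary.Unique.Propositional using (Unique)
open import Relation.Binary.PropositionalEquality using (_≡_; _≢_)

record Graph : Set₁ where
  field
    V   : Set
    Adj : V → V → Set

module _ (G : Graph) where
  open Graph G

  data Walk : V → V → ℕ → Set where
    [] : ∀ {x} → Walk x x zero
    _∷_ : ∀ {x y z n} → Adj x y → Walk y z n → Walk x z (suc n)

  Dist : V → V → ℕ → Set
  Dist x y n = Walk x y n × (∀ m → Walk x y m → n ≤ m)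

  Resolves : V → V → V → Set
  Resolves α β γ = ∃[ k₁ ] ∃[ k₂ ] (Dist α β k₁ × Dist α γ k₂ × k₁ ≢ k₂)

  IsMetricGenerator : List V → Set
  IsMetricGenerator U = ∀ β γ → β ≢ γ → ∃[ α ] (α ∈ U × Resolves α β γ)

  HasMetricDimension : ℕ → Set
  HasMetricDimension k =
    (∃[ U ] (Unique U × length U ≡ k × IsMetricGenerator U)) ×
    (∀ U → Unique U → IsMetricGenerator U → k ≤ length U)

-- Hexagonal lattice model.
-- Hexagon centres are points (Q,R) of the triangular lattice in axial
-- coordinates; neighbours of (Q,R) are (Q±1,R), (Q,R±1), (Q+1,R-1), (Q-1,R+1).
-- Vertices (atoms) of the hexagonal lattice are the lattice triangles:
--   up   (x,y) with centres (x,y), (x+1,y), (x,y+1)          -- tag true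
--   down (x,y) with centres (x+1,y), (x,y+1), (x+1,y+1)      -- tag false
-- Two vertices are joined (lattice edge) iff the triangles share a side;
-- the edge belongs to the two hexagons at the shared side's endpoints.

-- The hexagons of FCS_{a,b,c}.  Internal coordinates q = Q-1, r = R-1.
-- Coronoid HC_{a,b,c}: boundary of the lattice hexagon
--   0 ≤ q ≤ a+c-2, 0 ≤ r ≤ b+c-2, c-1 ≤ q+r ≤ a+b+c-3
-- (sides of a, b, c, a, b, c hexagons).
-- Starphene: centre (c-1, b-1); arm of a-2 hexagons along r = b-1
-- (parallel to the a-chains), arm of b-2 hexagons along q = c-1
-- (parallel to the b-chains), arm of c-2 hexagons along q+r = b+c-2
-- (parallel to the c-chains); terminal hexagons are corners of the hole.
ringHex : ℕ → ℕ → ℕ → ℕ → ℕ → Bool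
ringHex a b c q r =
  (q ≤ᵇ (a + c ∸ 2)) ∧ (r ≤ᵇ (b + c ∸ 2)) ∧
  ((c ∸ 1) ≤ᵇ (q + r)) ∧ ((q + r) ≤ᵇ (a + b + c ∸ 3)) ∧
  ((q ≡ᵇ 0) ∨ (q ≡ᵇ (a + c ∸ 2)) ∨ (r ≡ᵇ 0) ∨ (r ≡ᵇ (b + c ∸ 2)) ∨
   ((q + r) ≡ᵇ (c ∸ 1)) ∨ ((q + r) ≡ᵇ (a + b + c ∸ 3)))

starHex : ℕ → ℕ → ℕ → ℕ → ℕ → Bool
starHex a b c q r =
  ((r ≡ᵇ (b ∸ 1)) ∧ ((c ∸ 1) ≤ᵇ q) ∧ (q ≤ᵇ (a + c ∸ 3))) ∨
  ((q ≡ᵇ (c ∸ 1)) ∧ (1 ≤ᵇ r) ∧ (r ≤ᵇ (b ∸ 1))) ∨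
  (((q + r) ≡ᵇ (b + c ∸ 2)) ∧ (1 ≤ᵇ q) ∧ (q ≤ᵇ (c ∸ 1)))

fcsHex : ℕ → ℕ → ℕ → ℕ → ℕ → Bool
fcsHex a b c zero R = false
fcsHex a b c (suc q) zero = false
fcsHex a b c (suc q) (suc r) = ringHex a b c q r ∨ starHex a b c q r

-- lattice vertex: (x , y , tag), tag true = up, false = down
LVertex : Set
LVertex = ℕ × ℕ × Bool

isVertex : ℕ → ℕ → ℕ → LVertex → Bool
isVertex a b c (x , y , true)  =
  fcsHex a b c x y ∨ fcsHex a b c (suc x) y ∨ fcsHex a b c x (suc y)
isVertex a b c (x , y , false) =
  fcsHex a b c (suc x) y ∨ fcsHex a b c x (suc y) ∨ fcsHex a b c (suc x) (suc y)

upDownEdge : ℕ → ℕ → ℕ → ℕ → ℕ → ℕ → ℕ → Bool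
upDownEdge a b c x y x' y' =
  ((x' ≡ᵇ x) ∧ (y' ≡ᵇ y) ∧ (fcsHex a b c (suc x) y ∨ fcsHex a b c x (suc y))) ∨
  (((suc x') ≡ᵇ x) ∧ (y' ≡ᵇ y) ∧ (fcsHex a b c x y ∨ fcsHex a b c x (suc y))) ∨
  ((x' ≡ᵇ x) ∧ ((suc y') ≡ᵇ y) ∧ (fcsHex a b c x y ∨ fcsHex a b c (suc x) y))

isEdge : ℕ → ℕ → ℕ → LVertex → LVertex → Bool
isEdge a b c (x , y , true)  (x' , y' , false) = upDownEdge a b c x y x' y'
isEdge a b c (x , y , false) (x' , y' , true)  = upDownEdge a b c x' y' x y
isEdge a b c _ _ = false

FCS : ℕ → ℕ → ℕ → Graph
FCS a b c = record
  { V   = Σ LVertex (λ v → T (isVertex a b c v))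
  ; Adj = λ u v → T (isEdge a b c (Σ.proj₁ u) (Σ.proj₁ v))
  }

{-# OPTIONS --safe #-}
module Submission where

-- Write the side lengths as 4 + a, 4 + b, 4 + c.  The graph is a union of nine
-- straight chains of hexagons, so its vertices split into 90 regions: 54 single
-- vertices near the places where chains meet, and 36 families running along a
-- chain, indexed by pairs (i , j) with i + j equal to a, b or c.  The distance
-- from a single vertex o is, on each region, one linear form in a, b, c, i, j:
-- it suffices that these forms vanish at o, change by at most 1 along every edge
-- and decrease along some edge at every other vertex, and each of these is a
-- comparison of coefficients.
--
-- Upper bound: take an outer vertex of each of the three corner hexagons where
-- an arm is attached.  The colour together with the three distances maps each
-- region to a segment, and any two segments are separated by a linear functional
-- with coefficients in {-1, 0, 1}.
--
-- Lower bound: there are 39 pairs of vertices such that for any two regions some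
-- pair is equidistant from all vertices of both.  Hence two vertices never
-- resolve everything.

-- A distance can be a single linear form on each region because of the shape of the holes. Each of
-- the three holes is bounded by two arms and two sides of the coronoid that form a parallelogram.
-- From a vertex near one of its corners the two ways round therefore meet near the opposite corner,
-- whatever the side lengths, and no chain has to be cut at a point where the shortest route
-- switches. This is why all sources lie around the hub and the arm tips. The second hexagon of each
-- side next to an arm tip is split off as a knee because some sources lie on it. Although the lower
-- bound concerns arbitrary pairs of landmarks, distances from these few sources suffice: the
-- vertices to be confused are sources, and distance is symmetric. Side length 4 is the least for
-- which a side splits into corner, knee, a nonempty long part and end.

open import Defs
open import Data.Bool using (Bool; true; false; _∧_; _∨_; not; T; if_then_else_)
open import Data.Bool.ListAction using (all)
open import Data.Bool.Properties using (T-∧; T-∨; T-≡; T-irrelevant; T?)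
open import Data.Empty using (⊥; ⊥-elim)
open import Data.Fin as Fin using (Fin; #_)
open import Data.Fin.Patterns
open import Data.Integer as ℤ using (ℤ; 0ℤ; 1ℤ; -1ℤ)
import Data.Integer.Properties as ℤ
import Data.Integer.Tactic.RingSolver as ℤ-Solver
open import Data.List using (List; []; _∷_; map; length; allFin; cartesianProduct; cartesianProductWith)
open import Data.List.Membership.Propositional using (_∈_)
open import Data.List.Membership.Propositional.Properties using (∈-allFin; ∈-cartesianProduct⁺; ∈-map⁺)
open import Data.List.Relation.Unary.All as All using ([]; _∷_)
open import Data.List.Relation.Unary.All.Properties using (all⁺)
open import Data.List.Relation.Unary.AllPairs using ([]; _∷_)
open import Data.List.Relation.Unary.Any using (here; there)
open import Data.List.Relation.Unary.Unique.Propositional using (Unique)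
open import Data.Maybe using (Maybe; just; nothing; is-nothing)
open import Data.Nat
open import Data.Nat.Properties
open import Data.Nat.Tactic.RingSolver using (solve-∀)
open import Data.Product using (_×_; _,_; proj₁; proj₂; uncurry; ∃-syntax)
open import Data.Product.Properties using (≡-dec)
open import Data.Sum using (_⊎_; inj₁; inj₂; [_,_]′)
open import Data.Unit using (⊤; tt)
open import Data.Vec as Vec using (Vec; []; _∷_; lookup)
open import Data.Vec.Properties using (lookup-map)
open import Function using (_∘_)
open import Function.Bundles using (Equivalence)
open import Relation.Binary using (DecidableEquality; tri<; tri≈; tri>)
open import Relation.Binary.PropositionalEquality
open import Relation.Nullary using (Dec; yes; no; does; ¬_)

open Equivalence using (to; from)

-- Linear forms and regions

-- The form const + ca·a + cb·b + cc·c + ci·i + cj·j.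
record Form : Set where
  constructor form
  field const ca cb cc ci cj : ℕ

open Form

-- Sector k consists of the arm parallel to the k-th parameter (in the order
-- a, b, c) and of the two sides of the coronoid starting at the tip of that arm.
-- The rotation by 120° permutes the sectors and the parameters simultaneously.
Sector : Set
Sector = Fin 3

Span : Set
Span = Maybe Sector

-- Points (i′ , j′) of a region with i′ + j′ equal to its span s, in terms of i, j:
-- (0 , s), (s , 0), (1 + i , j) and (i , 1 + j) respectively.
Mode : Set
Mode = Fin 4

pattern start = 0F
pattern end   = 1F
pattern fore  = 2F
pattern back  = 3F

infixl 6 _⊞_
infix 4 _≤ᶠ_ _≡ᶠ_

_⊞_ : Form → Form → Form
form k x y z m n ⊞ form k′ x′ y′ z′ m′ n′ =
  form (k + k′) (x + x′) (y + y′) (z + z′) (m + m′) (n + n′)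

_≤ᶠ_ : Form → Form → Bool
form k x y z m n ≤ᶠ form k′ x′ y′ z′ m′ n′ =
  (k ≤ᵇ k′) ∧ (x ≤ᵇ x′) ∧ (y ≤ᵇ y′) ∧ (z ≤ᵇ z′) ∧ (m ≤ᵇ m′) ∧ (n ≤ᵇ n′)

_≡ᶠ_ : Form → Form → Bool
F ≡ᶠ G = (F ≤ᶠ G) ∧ (G ≤ᶠ F)

num : ℕ → Form
num k = form k 0 0 0 0 0

scale : Sector → ℕ → Form
scale 0F n = form 0 n 0 0 0 0
scale 1F n = form 0 0 n 0 0 0
scale 2F n = form 0 0 0 n 0 0

spanForm : Span → ℕ → Form
spanForm nothing  n = num 0
spanForm (just p) n = scale p n

-- In the modes fore and back the spanned parameter is i + j + 1; eliminating it
-- makes the remaining variables independent, so that comparing forms amounts to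
-- comparing coefficients.
eliminate : Sector → ℕ → Form → Form
eliminate 0F e (form k x y z m n) = form (k + x + e) 0 y z (m + x) (n + x)
eliminate 1F e (form k x y z m n) = form (k + y + e) x 0 z (m + y) (n + y)
eliminate 2F e (form k x y z m n) = form (k + z + e) x y 0 (m + z) (n + z)

-- The constant handed to `eliminate` comes from the successor: putting 1 + i for i adds one copy of
-- the coefficient of i. The clauses for `nothing` are fillers, since such a region has i + j = 0
-- and hence no point in these modes.
inst : Mode → Span → Form → Form
inst start s (form k x y z m n) = form k x y z 0 0 ⊞ spanForm s n
inst end   s (form k x y z m n) = form k x y z 0 0 ⊞ spanForm s m
inst fore (just p) F = eliminate p (ci F) F
inst back (just p) F = eliminate p (cj F) F
inst fore nothing  F = F
inst back nothing  F = F

turn : Sector → Sector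
turn 0F = 1F
turn 1F = 2F
turn 2F = 0F

infixr 6 _⊕_
_⊕_ : Sector → Sector → Sector
0F ⊕ k = k
1F ⊕ k = turn k
2F ⊕ k = turn (turn k)

opposite : Sector → Sector
opposite 0F = 0F
opposite 1F = 2F
opposite 2F = 1F

-- The cyclic renaming a → b → c → a, applied k times; it carries a distance measured from sector 0
-- to one measured from sector k.
rotate : Sector → Form → Form
rotate 0F F = F
rotate 1F (form k x y z m n) = form k z x y m n
rotate 2F (form k x y z m n) = form k y z x m n

data Chain : Set where
  armᶜ leftᶜ rightᶜ : Chain

axis : Sector → Chain → Sector
axis k armᶜ   = k
axis k leftᶜ  = 1F ⊕ k
axis k rightᶜ = 2F ⊕ k

-- Position of the hexagon with J predecessors and J* successors in a chain; arms
-- start at the centre, sides at the tip of the arm of their sector.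
nodeᶠ : Sector → Chain → Form → Form → Form × Form
nodeᶠ 0F armᶜ   J J* = form 3 0 0 1 0 0 ⊞ J  , form 3 0 1 0 0 0
nodeᶠ 0F leftᶜ  J J* = form 6 1 0 1 0 0      , J*
nodeᶠ 0F rightᶜ J J* = form 3 1 0 0 0 0 ⊞ J* , form 3 0 1 0 0 0 ⊞ J
nodeᶠ 1F armᶜ   J J* = form 3 0 0 1 0 0      , num 1 ⊞ J*
nodeᶠ 1F leftᶜ  J J* = J*                    , J
nodeᶠ 1F rightᶜ J J* = form 3 0 0 1 0 0 ⊞ J  , num 0
nodeᶠ 2F armᶜ   J J* = num 1 ⊞ J*            , form 3 0 1 0 0 0 ⊞ J
nodeᶠ 2F leftᶜ  J J* = J                     , form 6 0 1 1 0 0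
nodeᶠ 2F rightᶜ J J* = num 0                 , form 3 0 0 1 0 0 ⊞ J*

data Piece : Set where
  hub arm tip cornerˡ kneeˡ sideˡ endˡ cornerʳ kneeʳ sideʳ endʳ : Piece

pieces : List Piece
pieces = hub ∷ arm ∷ tip ∷ cornerˡ ∷ kneeˡ ∷ sideˡ ∷ endˡ ∷ cornerʳ ∷ kneeʳ ∷ sideʳ ∷ endʳ ∷ []

chain : Piece → Chain
chain hub     = armᶜ
chain arm     = armᶜ
chain tip     = armᶜ
chain cornerˡ = leftᶜ
chain kneeˡ   = leftᶜ
chain sideˡ   = leftᶜ
chain endˡ    = leftᶜ
chain cornerʳ = rightᶜ
chain kneeʳ   = rightᶜ
chain sideʳ   = rightᶜ
chain endʳ    = rightᶜ

long : Piece → Bool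
long arm   = true
long sideˡ = true
long sideʳ = true
long _     = false

span : Sector → Piece → Span
span k π = if long π then just (axis k (chain π)) else nothing

-- u is the parameter measuring the chain of the piece.
place : Piece → Form → Form × Form
place hub     u = num 0     , num 2 ⊞ u
place arm     u = form 1 0 0 0 1 0 , form 1 0 0 0 0 1
place tip     u = num 2 ⊞ u , num 0
place cornerˡ u = num 0     , num 3 ⊞ u
place kneeˡ   u = num 1     , num 2 ⊞ u
place sideˡ   u = form 2 0 0 0 1 0 , form 1 0 0 0 0 1
place endˡ    u = num 3 ⊞ u , num 0
place cornerʳ u = num 0     , num 3 ⊞ u
place kneeʳ   u = num 1     , num 2 ⊞ u
place sideʳ   u = form 2 0 0 0 1 0 , form 1 0 0 0 0 1
place endʳ    u = num 3 ⊞ u , num 0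

hexᶠ : Sector → Piece → Form × Form
hexᶠ k π = uncurry (nodeᶠ k (chain π)) (place π (scale (axis k (chain π)) 1))

next : Fin 6 → Fin 6
next 0F = 1F
next 1F = 2F
next 2F = 3F
next 3F = 4F
next 4F = 5F
next 5F = 0F

-- Corners of a hexagon are numbered cyclically; spin k converts the numbering
-- relative to sector k to the absolute one of cornerᶠ.
spin : Sector → Fin 6 → Fin 6
spin 0F t = t
spin 1F t = next (next (next (next t)))
spin 2F t = next (next t)

cornerᶠ : Fin 6 → Form × Form → Vec Form 3
cornerᶠ 0F (x , y) = x         ∷ num 1 ⊞ y ∷ num 1 ∷ []
cornerᶠ 1F (x , y) = x         ∷ y         ∷ num 0 ∷ []
cornerᶠ 2F (x , y) = num 1 ⊞ x ∷ y         ∷ num 1 ∷ []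
cornerᶠ 3F (x , y) = num 1 ⊞ x ∷ y         ∷ num 0 ∷ []
cornerᶠ 4F (x , y) = num 1 ⊞ x ∷ num 1 ⊞ y ∷ num 1 ∷ []
cornerᶠ 5F (x , y) = x         ∷ num 1 ⊞ y ∷ num 0 ∷ []

Region : Set
Region = Sector × Fin 30

-- A region is formed by one corner of the hexagons of one piece; a vertex lying
-- on several hexagons occurs for one of them only.
owner : Vec (Piece × Fin 6) 30
owner =
  (hub , # 4) ∷ (hub , # 3) ∷ (arm , # 4) ∷ (arm , # 3) ∷
  (arm , # 2) ∷ (arm , # 5) ∷ (tip , # 2) ∷ (tip , # 5) ∷
  (tip , # 4) ∷ (tip , # 3) ∷ (cornerˡ , # 2) ∷ (cornerˡ , # 5) ∷
  (cornerˡ , # 3) ∷ (cornerˡ , # 4) ∷ (kneeˡ , # 2) ∷ (kneeˡ , # 1) ∷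
  (kneeˡ , # 3) ∷ (sideˡ , # 2) ∷ (sideˡ , # 1) ∷ (sideˡ , # 0) ∷
  (sideˡ , # 3) ∷ (kneeʳ , # 0) ∷ (kneeʳ , # 5) ∷ (kneeʳ , # 4) ∷
  (sideʳ , # 0) ∷ (sideʳ , # 5) ∷ (sideʳ , # 1) ∷ (sideʳ , # 4) ∷
  (endˡ , # 2) ∷ (endˡ , # 3) ∷ []

-- The regions of the six corners of the first hexagon of a piece in sector 0, and
-- of the later hexagons of a long piece.
firstCorners : Piece → Vec (Region × Mode) 6
firstCorners hub =
  ((2F , # 0) , start) ∷ ((1F , # 1) , start) ∷ ((1F , # 0) , start) ∷
  ((0F , # 1) , start) ∷ ((0F , # 0) , start) ∷ ((2F , # 1) , start) ∷ []
firstCorners arm =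
  ((0F , # 0) , start) ∷ ((0F , # 1) , start) ∷ ((0F , # 4) , start) ∷
  ((0F , # 3) , start) ∷ ((0F , # 2) , start) ∷ ((0F , # 5) , start) ∷ []
firstCorners tip =
  ((0F , # 2) , end) ∷ ((0F , # 3) , end) ∷ ((0F , # 6) , start) ∷
  ((0F , # 9) , start) ∷ ((0F , # 8) , start) ∷ ((0F , # 7) , start) ∷ []
firstCorners cornerˡ =
  ((0F , # 8) , start) ∷ ((0F , # 9) , start) ∷ ((0F , # 10) , start) ∷
  ((0F , # 12) , start) ∷ ((0F , # 13) , start) ∷ ((0F , # 11) , start) ∷ []
firstCorners kneeˡ =
  ((0F , # 6) , start) ∷ ((0F , # 15) , start) ∷ ((0F , # 14) , start) ∷
  ((0F , # 16) , start) ∷ ((0F , # 10) , start) ∷ ((0F , # 9) , start) ∷ []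
firstCorners sideˡ =
  ((0F , # 19) , start) ∷ ((0F , # 18) , start) ∷ ((0F , # 17) , start) ∷
  ((0F , # 20) , start) ∷ ((0F , # 14) , start) ∷ ((0F , # 15) , start) ∷ []
firstCorners endˡ =
  ((1F , # 24) , end) ∷ ((1F , # 25) , end) ∷ ((0F , # 28) , start) ∷
  ((0F , # 29) , start) ∷ ((0F , # 17) , end) ∷ ((0F , # 18) , end) ∷ []
firstCorners cornerʳ = firstCorners cornerˡ
firstCorners kneeʳ =
  ((0F , # 21) , start) ∷ ((0F , # 7) , start) ∷ ((0F , # 8) , start) ∷
  ((0F , # 11) , start) ∷ ((0F , # 23) , start) ∷ ((0F , # 22) , start) ∷ []
firstCorners sideʳ =
  ((0F , # 24) , start) ∷ ((0F , # 26) , start) ∷ ((0F , # 21) , start) ∷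
  ((0F , # 22) , start) ∷ ((0F , # 27) , start) ∷ ((0F , # 25) , start) ∷ []
firstCorners endʳ =
  ((2F , # 17) , end) ∷ ((2F , # 18) , end) ∷ ((0F , # 24) , end) ∷
  ((0F , # 25) , end) ∷ ((2F , # 28) , start) ∷ ((2F , # 29) , start) ∷ []

laterCorners : Piece → Vec (Region × Mode) 6
laterCorners arm =
  ((0F , # 2) , back) ∷ ((0F , # 3) , back) ∷ ((0F , # 4) , fore) ∷
  ((0F , # 3) , fore) ∷ ((0F , # 2) , fore) ∷ ((0F , # 5) , fore) ∷ []
laterCorners sideˡ =
  ((0F , # 19) , fore) ∷ ((0F , # 18) , fore) ∷ ((0F , # 17) , fore) ∷
  ((0F , # 20) , fore) ∷ ((0F , # 17) , back) ∷ ((0F , # 18) , back) ∷ []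
laterCorners sideʳ =
  ((0F , # 24) , fore) ∷ ((0F , # 26) , fore) ∷ ((0F , # 24) , back) ∷
  ((0F , # 25) , back) ∷ ((0F , # 27) , fore) ∷ ((0F , # 25) , fore) ∷ []
laterCorners π = firstCorners π

homePiece : Region → Piece
homePiece (k , b) = proj₁ (lookup owner b)

homeCorner : Region → Fin 6
homeCorner (k , b) = proj₂ (lookup owner b)

extent : Region → Span
extent r = span (proj₁ r) (homePiece r)

posᶠ : Region → Vec Form 3
posᶠ r = cornerᶠ (spin (proj₁ r) (homeCorner r)) (hexᶠ (proj₁ r) (homePiece r))

shift : Sector → Region × Mode → Region × Mode
shift k ((k′ , b) , m) = (k ⊕ k′ , b) , m

corners : Bool → Piece → Vec (Region × Mode) 6
corners false = firstCorners
corners true  = laterCorners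

phase : Bool → Mode
phase false = start
phase true  = fore

_==ˢ_ : Span → Span → Bool
nothing  ==ˢ nothing  = true
just p   ==ˢ just p′  = does (p Fin.≟ p′)
_        ==ˢ _        = false

-- The variables of a later hexagon satisfy 1 + i + j = its span, so a corner may be read in mode
-- `fore` or `back` only if its region is spanned by the same parameter. The two ends of a region
-- use no variables.
admissible : Bool → Mode → Span → Span → Bool
admissible later start s s′ = true
admissible later end   s s′ = true
admissible later fore  s s′ = later ∧ (s ==ˢ s′)
admissible later back  s s′ = later ∧ (s ==ˢ s′)

all≡ᶠ : ∀ {n} → Vec Form n → Vec Form n → Bool
all≡ᶠ []       []       = true
all≡ᶠ (F ∷ Fs) (G ∷ Gs) = (F ≡ᶠ G) ∧ all≡ᶠ Fs Gs

regions : List Region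
regions = cartesianProduct (allFin 3) (allFin 30)

-- One hexagon in symbolic position; the flag marks those after the first of a long piece. Eleven
-- pieces, three of them long, in three sectors make 42 charts, and these describe all hexagons for
-- all side lengths.
Chart : Set
Chart = Sector × Piece × Bool

allCharts : (Chart → Bool) → Bool
allCharts p = all (λ k → all (λ π → p (k , π , false) ∧ (not (long π) ∨ p (k , π , true))) pieces) (allFin 3)

hexAtlas : Chart → Form × Form
hexAtlas (k , π , later) =
  let (q , q′) = hexᶠ k π in inst (phase later) (span k π) q , inst (phase later) (span k π) q′

slotOf : Chart → Fin 6 → Region × Mode
slotOf (k , π , later) t = shift k (lookup (corners later π) t)

fits : Chart → Fin 6 → Region × Mode → Bool
fits χ@(k , π , later) t (r , m) =
  admissible later m (extent r) (span k π) ∧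
  all≡ᶠ (Vec.map (inst m (extent r)) (posᶠ r)) (cornerᶠ (spin k t) (hexAtlas χ))

wellPlaced : Chart → Bool
wellPlaced χ = all (λ t → fits χ t (slotOf χ t)) (allFin 6)

-- A second hexagon at each vertex of degree 3 (for a long region: the hexagon
-- behind its end), so that owner and otherFace together show all neighbours.
otherFace : Vec (Maybe (Piece × Fin 6)) 30
otherFace =
  just (arm , # 0) ∷ just (arm , # 1) ∷ just (tip , # 0) ∷
  just (tip , # 1) ∷ nothing ∷ nothing ∷
  just (kneeˡ , # 0) ∷ just (kneeʳ , # 1) ∷ just (cornerˡ , # 0) ∷
  just (cornerˡ , # 1) ∷ just (kneeˡ , # 4) ∷ just (kneeʳ , # 3) ∷
  nothing ∷ nothing ∷ just (sideˡ , # 4) ∷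
  just (sideˡ , # 5) ∷ nothing ∷ just (endˡ , # 4) ∷
  just (endˡ , # 5) ∷ nothing ∷ nothing ∷
  just (sideʳ , # 2) ∷ just (sideʳ , # 3) ∷ nothing ∷
  just (endʳ , # 2) ∷ just (endʳ , # 3) ∷ nothing ∷
  nothing ∷ nothing ∷ nothing ∷ []

-- Distances from the eleven sources of sector 0 to the regions of sectors 0, 1, 2
-- at a = b = c = i = j = 0.
constants : Vec (Vec (Vec ℕ 30) 3) 11
constants =
  ((0 ∷ 1 ∷ 2 ∷ 3 ∷ 2 ∷ 1 ∷ 4 ∷ 3 ∷ 4 ∷ 5 ∷ 6 ∷ 5 ∷ 7 ∷ 6 ∷ 6 ∷
    5 ∷ 7 ∷ 8 ∷ 7 ∷ 6 ∷ 7 ∷ 4 ∷ 5 ∷ 6 ∷ 6 ∷ 7 ∷ 5 ∷ 6 ∷ 10 ∷ 9 ∷ []) ∷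
   (2 ∷ 3 ∷ 4 ∷ 5 ∷ 4 ∷ 3 ∷ 6 ∷ 5 ∷ 6 ∷ 7 ∷ 8 ∷ 7 ∷ 9 ∷ 8 ∷ 8 ∷
    7 ∷ 9 ∷ 10 ∷ 9 ∷ 8 ∷ 9 ∷ 6 ∷ 7 ∷ 8 ∷ 8 ∷ 9 ∷ 7 ∷ 8 ∷ 10 ∷ 11 ∷ []) ∷
   (2 ∷ 1 ∷ 4 ∷ 3 ∷ 2 ∷ 3 ∷ 4 ∷ 5 ∷ 6 ∷ 5 ∷ 6 ∷ 7 ∷ 7 ∷ 8 ∷ 6 ∷
    5 ∷ 7 ∷ 8 ∷ 7 ∷ 6 ∷ 7 ∷ 6 ∷ 7 ∷ 8 ∷ 8 ∷ 9 ∷ 7 ∷ 8 ∷ 8 ∷ 9 ∷ []) ∷ []) ∷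
  ((4 ∷ 3 ∷ 2 ∷ 1 ∷ 2 ∷ 3 ∷ 0 ∷ 3 ∷ 2 ∷ 1 ∷ 2 ∷ 3 ∷ 3 ∷ 4 ∷ 2 ∷
    1 ∷ 3 ∷ 4 ∷ 3 ∷ 2 ∷ 3 ∷ 4 ∷ 5 ∷ 4 ∷ 6 ∷ 7 ∷ 5 ∷ 6 ∷ 6 ∷ 5 ∷ []) ∷
   (4 ∷ 5 ∷ 6 ∷ 7 ∷ 6 ∷ 5 ∷ 8 ∷ 7 ∷ 8 ∷ 9 ∷ 10 ∷ 9 ∷ 11 ∷ 10 ∷ 10 ∷
    9 ∷ 11 ∷ 12 ∷ 11 ∷ 10 ∷ 11 ∷ 6 ∷ 7 ∷ 8 ∷ 4 ∷ 5 ∷ 5 ∷ 6 ∷ 14 ∷ 13 ∷ []) ∷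
   (6 ∷ 5 ∷ 8 ∷ 7 ∷ 6 ∷ 7 ∷ 8 ∷ 9 ∷ 10 ∷ 9 ∷ 10 ∷ 11 ∷ 11 ∷ 12 ∷ 10 ∷
    9 ∷ 11 ∷ 8 ∷ 7 ∷ 8 ∷ 9 ∷ 10 ∷ 11 ∷ 12 ∷ 12 ∷ 13 ∷ 11 ∷ 12 ∷ 8 ∷ 9 ∷ []) ∷ []) ∷
  ((3 ∷ 4 ∷ 1 ∷ 2 ∷ 3 ∷ 2 ∷ 3 ∷ 0 ∷ 1 ∷ 2 ∷ 3 ∷ 2 ∷ 4 ∷ 3 ∷ 5 ∷
    4 ∷ 4 ∷ 7 ∷ 6 ∷ 5 ∷ 6 ∷ 1 ∷ 2 ∷ 3 ∷ 3 ∷ 4 ∷ 2 ∷ 3 ∷ 9 ∷ 8 ∷ []) ∷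
   (5 ∷ 6 ∷ 7 ∷ 8 ∷ 7 ∷ 6 ∷ 9 ∷ 8 ∷ 9 ∷ 10 ∷ 11 ∷ 10 ∷ 12 ∷ 11 ∷ 11 ∷
    10 ∷ 12 ∷ 13 ∷ 12 ∷ 11 ∷ 12 ∷ 9 ∷ 10 ∷ 11 ∷ 7 ∷ 8 ∷ 8 ∷ 9 ∷ 13 ∷ 14 ∷ []) ∷
   (5 ∷ 4 ∷ 7 ∷ 6 ∷ 5 ∷ 6 ∷ 7 ∷ 8 ∷ 9 ∷ 8 ∷ 9 ∷ 10 ∷ 10 ∷ 11 ∷ 7 ∷
    6 ∷ 8 ∷ 5 ∷ 4 ∷ 5 ∷ 6 ∷ 9 ∷ 10 ∷ 11 ∷ 11 ∷ 12 ∷ 10 ∷ 11 ∷ 5 ∷ 6 ∷ []) ∷ []) ∷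
  ((4 ∷ 5 ∷ 2 ∷ 3 ∷ 4 ∷ 3 ∷ 2 ∷ 1 ∷ 0 ∷ 1 ∷ 2 ∷ 1 ∷ 3 ∷ 2 ∷ 4 ∷
    3 ∷ 3 ∷ 6 ∷ 5 ∷ 4 ∷ 5 ∷ 2 ∷ 3 ∷ 2 ∷ 4 ∷ 5 ∷ 3 ∷ 4 ∷ 8 ∷ 7 ∷ []) ∷
   (6 ∷ 7 ∷ 8 ∷ 9 ∷ 8 ∷ 7 ∷ 10 ∷ 9 ∷ 10 ∷ 11 ∷ 12 ∷ 11 ∷ 13 ∷ 12 ∷ 12 ∷
    11 ∷ 13 ∷ 14 ∷ 13 ∷ 12 ∷ 13 ∷ 8 ∷ 9 ∷ 10 ∷ 6 ∷ 7 ∷ 7 ∷ 8 ∷ 14 ∷ 15 ∷ []) ∷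
   (6 ∷ 5 ∷ 8 ∷ 7 ∷ 6 ∷ 7 ∷ 8 ∷ 9 ∷ 10 ∷ 9 ∷ 10 ∷ 11 ∷ 11 ∷ 12 ∷ 8 ∷
    7 ∷ 9 ∷ 6 ∷ 5 ∷ 6 ∷ 7 ∷ 10 ∷ 11 ∷ 12 ∷ 12 ∷ 13 ∷ 11 ∷ 12 ∷ 6 ∷ 7 ∷ []) ∷ []) ∷
  ((5 ∷ 4 ∷ 3 ∷ 2 ∷ 3 ∷ 4 ∷ 1 ∷ 2 ∷ 1 ∷ 0 ∷ 1 ∷ 2 ∷ 2 ∷ 3 ∷ 3 ∷
    2 ∷ 2 ∷ 5 ∷ 4 ∷ 3 ∷ 4 ∷ 3 ∷ 4 ∷ 3 ∷ 5 ∷ 6 ∷ 4 ∷ 5 ∷ 7 ∷ 6 ∷ []) ∷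
   (5 ∷ 6 ∷ 7 ∷ 8 ∷ 7 ∷ 6 ∷ 9 ∷ 8 ∷ 9 ∷ 10 ∷ 11 ∷ 10 ∷ 12 ∷ 11 ∷ 11 ∷
    10 ∷ 12 ∷ 13 ∷ 12 ∷ 11 ∷ 12 ∷ 7 ∷ 8 ∷ 9 ∷ 5 ∷ 6 ∷ 6 ∷ 7 ∷ 15 ∷ 14 ∷ []) ∷
   (7 ∷ 6 ∷ 9 ∷ 8 ∷ 7 ∷ 8 ∷ 9 ∷ 10 ∷ 11 ∷ 10 ∷ 11 ∷ 12 ∷ 12 ∷ 13 ∷ 9 ∷
    8 ∷ 10 ∷ 7 ∷ 6 ∷ 7 ∷ 8 ∷ 11 ∷ 12 ∷ 13 ∷ 13 ∷ 14 ∷ 12 ∷ 13 ∷ 7 ∷ 8 ∷ []) ∷ []) ∷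
  ((7 ∷ 6 ∷ 5 ∷ 4 ∷ 5 ∷ 6 ∷ 3 ∷ 4 ∷ 3 ∷ 2 ∷ 1 ∷ 2 ∷ 0 ∷ 1 ∷ 3 ∷
    4 ∷ 2 ∷ 5 ∷ 6 ∷ 5 ∷ 4 ∷ 5 ∷ 4 ∷ 3 ∷ 7 ∷ 6 ∷ 6 ∷ 5 ∷ 7 ∷ 6 ∷ []) ∷
   (7 ∷ 8 ∷ 9 ∷ 10 ∷ 9 ∷ 8 ∷ 11 ∷ 10 ∷ 11 ∷ 12 ∷ 13 ∷ 12 ∷ 14 ∷ 13 ∷ 13 ∷
    12 ∷ 14 ∷ 15 ∷ 14 ∷ 13 ∷ 14 ∷ 9 ∷ 10 ∷ 11 ∷ 7 ∷ 8 ∷ 8 ∷ 9 ∷ 17 ∷ 16 ∷ []) ∷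
   (9 ∷ 8 ∷ 11 ∷ 10 ∷ 9 ∷ 10 ∷ 11 ∷ 12 ∷ 13 ∷ 12 ∷ 13 ∷ 14 ∷ 14 ∷ 15 ∷ 11 ∷
    10 ∷ 12 ∷ 9 ∷ 8 ∷ 9 ∷ 10 ∷ 13 ∷ 14 ∷ 15 ∷ 15 ∷ 16 ∷ 14 ∷ 15 ∷ 7 ∷ 8 ∷ []) ∷ []) ∷
  ((6 ∷ 7 ∷ 4 ∷ 5 ∷ 6 ∷ 5 ∷ 4 ∷ 3 ∷ 2 ∷ 3 ∷ 2 ∷ 1 ∷ 1 ∷ 0 ∷ 4 ∷
    5 ∷ 3 ∷ 6 ∷ 7 ∷ 6 ∷ 5 ∷ 4 ∷ 3 ∷ 2 ∷ 6 ∷ 5 ∷ 5 ∷ 4 ∷ 8 ∷ 7 ∷ []) ∷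
   (8 ∷ 9 ∷ 10 ∷ 11 ∷ 10 ∷ 9 ∷ 12 ∷ 11 ∷ 12 ∷ 13 ∷ 14 ∷ 13 ∷ 15 ∷ 14 ∷ 14 ∷
    13 ∷ 15 ∷ 16 ∷ 15 ∷ 14 ∷ 15 ∷ 10 ∷ 11 ∷ 12 ∷ 8 ∷ 9 ∷ 9 ∷ 10 ∷ 16 ∷ 17 ∷ []) ∷
   (8 ∷ 7 ∷ 10 ∷ 9 ∷ 8 ∷ 9 ∷ 10 ∷ 11 ∷ 12 ∷ 11 ∷ 12 ∷ 13 ∷ 13 ∷ 14 ∷ 10 ∷
    9 ∷ 11 ∷ 8 ∷ 7 ∷ 8 ∷ 9 ∷ 12 ∷ 13 ∷ 14 ∷ 14 ∷ 15 ∷ 13 ∷ 14 ∷ 6 ∷ 7 ∷ []) ∷ []) ∷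
  ((5 ∷ 4 ∷ 3 ∷ 2 ∷ 3 ∷ 4 ∷ 1 ∷ 4 ∷ 3 ∷ 2 ∷ 3 ∷ 4 ∷ 4 ∷ 5 ∷ 1 ∷
    0 ∷ 2 ∷ 3 ∷ 2 ∷ 1 ∷ 2 ∷ 5 ∷ 6 ∷ 5 ∷ 7 ∷ 8 ∷ 6 ∷ 7 ∷ 5 ∷ 4 ∷ []) ∷
   (5 ∷ 6 ∷ 7 ∷ 8 ∷ 7 ∷ 6 ∷ 9 ∷ 6 ∷ 7 ∷ 8 ∷ 9 ∷ 8 ∷ 10 ∷ 9 ∷ 11 ∷
    10 ∷ 10 ∷ 13 ∷ 12 ∷ 11 ∷ 12 ∷ 5 ∷ 6 ∷ 7 ∷ 3 ∷ 4 ∷ 4 ∷ 5 ∷ 15 ∷ 14 ∷ []) ∷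
   (7 ∷ 6 ∷ 9 ∷ 8 ∷ 7 ∷ 8 ∷ 9 ∷ 10 ∷ 11 ∷ 10 ∷ 11 ∷ 12 ∷ 12 ∷ 13 ∷ 11 ∷
    10 ∷ 12 ∷ 9 ∷ 8 ∷ 9 ∷ 10 ∷ 11 ∷ 12 ∷ 13 ∷ 13 ∷ 14 ∷ 12 ∷ 13 ∷ 9 ∷ 10 ∷ []) ∷ []) ∷
  ((7 ∷ 6 ∷ 5 ∷ 4 ∷ 5 ∷ 6 ∷ 3 ∷ 4 ∷ 3 ∷ 2 ∷ 1 ∷ 4 ∷ 2 ∷ 3 ∷ 1 ∷
    2 ∷ 0 ∷ 3 ∷ 4 ∷ 3 ∷ 2 ∷ 5 ∷ 6 ∷ 5 ∷ 7 ∷ 8 ∷ 6 ∷ 7 ∷ 5 ∷ 4 ∷ []) ∷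
   (7 ∷ 8 ∷ 9 ∷ 10 ∷ 9 ∷ 8 ∷ 11 ∷ 8 ∷ 9 ∷ 10 ∷ 11 ∷ 10 ∷ 12 ∷ 11 ∷ 13 ∷
    12 ∷ 12 ∷ 15 ∷ 14 ∷ 13 ∷ 14 ∷ 7 ∷ 8 ∷ 9 ∷ 5 ∷ 6 ∷ 6 ∷ 7 ∷ 17 ∷ 16 ∷ []) ∷
   (9 ∷ 8 ∷ 11 ∷ 10 ∷ 9 ∷ 10 ∷ 11 ∷ 12 ∷ 13 ∷ 12 ∷ 13 ∷ 14 ∷ 14 ∷ 15 ∷ 11 ∷
    10 ∷ 12 ∷ 9 ∷ 8 ∷ 9 ∷ 10 ∷ 13 ∷ 14 ∷ 15 ∷ 15 ∷ 16 ∷ 14 ∷ 15 ∷ 9 ∷ 10 ∷ []) ∷ []) ∷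
  ((4 ∷ 5 ∷ 2 ∷ 3 ∷ 4 ∷ 3 ∷ 4 ∷ 1 ∷ 2 ∷ 3 ∷ 4 ∷ 3 ∷ 5 ∷ 4 ∷ 6 ∷
    5 ∷ 5 ∷ 8 ∷ 7 ∷ 6 ∷ 7 ∷ 0 ∷ 1 ∷ 2 ∷ 2 ∷ 3 ∷ 1 ∷ 2 ∷ 10 ∷ 9 ∷ []) ∷
   (6 ∷ 7 ∷ 8 ∷ 9 ∷ 8 ∷ 7 ∷ 10 ∷ 9 ∷ 10 ∷ 11 ∷ 12 ∷ 11 ∷ 13 ∷ 12 ∷ 12 ∷
    11 ∷ 13 ∷ 14 ∷ 13 ∷ 12 ∷ 13 ∷ 10 ∷ 11 ∷ 12 ∷ 8 ∷ 9 ∷ 9 ∷ 10 ∷ 14 ∷ 15 ∷ []) ∷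
   (6 ∷ 5 ∷ 8 ∷ 7 ∷ 6 ∷ 7 ∷ 6 ∷ 9 ∷ 8 ∷ 7 ∷ 8 ∷ 9 ∷ 9 ∷ 10 ∷ 6 ∷
    5 ∷ 7 ∷ 4 ∷ 3 ∷ 4 ∷ 5 ∷ 10 ∷ 11 ∷ 10 ∷ 12 ∷ 13 ∷ 11 ∷ 12 ∷ 4 ∷ 5 ∷ []) ∷ []) ∷
  ((6 ∷ 7 ∷ 4 ∷ 5 ∷ 6 ∷ 5 ∷ 4 ∷ 3 ∷ 2 ∷ 3 ∷ 4 ∷ 1 ∷ 3 ∷ 2 ∷ 6 ∷
    5 ∷ 5 ∷ 8 ∷ 7 ∷ 6 ∷ 7 ∷ 2 ∷ 1 ∷ 0 ∷ 4 ∷ 3 ∷ 3 ∷ 2 ∷ 10 ∷ 9 ∷ []) ∷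
   (8 ∷ 9 ∷ 10 ∷ 11 ∷ 10 ∷ 9 ∷ 12 ∷ 11 ∷ 12 ∷ 13 ∷ 14 ∷ 13 ∷ 15 ∷ 14 ∷ 14 ∷
    13 ∷ 15 ∷ 16 ∷ 15 ∷ 14 ∷ 15 ∷ 10 ∷ 11 ∷ 12 ∷ 8 ∷ 9 ∷ 9 ∷ 10 ∷ 16 ∷ 17 ∷ []) ∷
   (8 ∷ 7 ∷ 10 ∷ 9 ∷ 8 ∷ 9 ∷ 8 ∷ 11 ∷ 10 ∷ 9 ∷ 10 ∷ 11 ∷ 11 ∷ 12 ∷ 8 ∷
    7 ∷ 9 ∷ 6 ∷ 5 ∷ 6 ∷ 7 ∷ 12 ∷ 13 ∷ 12 ∷ 14 ∷ 15 ∷ 13 ∷ 14 ∷ 4 ∷ 5 ∷ []) ∷ []) ∷ []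

-- Sources and their distance forms

Source : Set
Source = Sector × Fin 11

-- The eleven vertices occurring in `twins₀`. The landmark, number 5, is among them: it is one of
-- the two outer vertices of the corner hexagon.
anchor : Vec (Fin 30) 11
anchor = # 0 ∷ # 6 ∷ # 7 ∷ # 8 ∷ # 9 ∷ # 12 ∷ # 13 ∷ # 15 ∷ # 16 ∷ # 21 ∷ # 23 ∷ []

site : Source → Region
site (k , s) = k , lookup anchor s

hubSlope : Sector → Piece → Form
hubSlope k hub   = num 0
hubSlope k arm   = form 0 0 0 0 2 0
hubSlope k sideˡ = scale k 2 ⊞ form 0 0 0 0 2 0
hubSlope k sideʳ = scale k 2 ⊞ form 0 0 0 0 2 0
hubSlope k endˡ  = scale k 2 ⊞ scale (1F ⊕ k) 2
hubSlope k _     = scale k 2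

-- The sector is counted from that of the source. `sideʳ` of the next sector and `sideˡ` of the
-- previous one are entered at the coronoid corner that they share with a side of the source sector,
-- so there the distance grows with j instead of i.
tipSlope : Sector → Piece → Form
tipSlope 0F hub   = form 0 2 0 0 0 0
tipSlope 0F arm   = form 0 0 0 0 0 2
tipSlope 0F sideˡ = form 0 0 0 0 2 0
tipSlope 0F sideʳ = form 0 0 0 0 2 0
tipSlope 0F endˡ  = form 0 0 2 0 0 0
tipSlope 0F _     = num 0
tipSlope 1F hub   = form 0 2 0 0 0 0
tipSlope 1F arm   = form 0 2 0 0 2 0
tipSlope 1F sideˡ = form 0 2 2 0 2 0
tipSlope 1F sideʳ = form 0 0 2 0 0 2
tipSlope 1F endˡ  = form 0 2 2 2 0 0
tipSlope 1F _     = form 0 2 2 0 0 0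
tipSlope 2F hub   = form 0 2 0 0 0 0
tipSlope 2F arm   = form 0 2 0 0 2 0
tipSlope 2F sideˡ = form 0 0 0 2 0 2
tipSlope 2F sideʳ = form 0 2 0 2 2 0
tipSlope 2F endˡ  = form 0 0 0 2 0 0
tipSlope 2F _     = form 0 2 0 2 0 0

slope : Fin 11 → Sector → Piece → Form
slope 0F = hubSlope
slope _  = tipSlope

distᶠ : Source → Region → Form
distᶠ (k , s) (k′ , b) =
  -- The sector of the region as seen from that of the source, that is, k′ - k modulo 3.
  let δ = opposite k ⊕ k′ in
  rotate k (num (lookup (lookup (lookup constants s) δ) b) ⊞ slope s δ (homePiece (k′ , b)))

-- Local conditions that characterise a distance

valueAt : (Region → Form) → Region × Mode → Form
valueAt f (r , m) = inst m (extent r) (f r)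

near : Form → Form → Bool
near F G = (F ≤ᶠ num 1 ⊞ G) ∧ (G ≤ᶠ num 1 ⊞ F)

cyclic : ∀ {A : Set} → (A → A → Bool) → (Fin 6 → A) → Bool
cyclic {A} R g = go (g 0F) (g 1F) (g 2F) (g 3F) (g 4F) (g 5F)
  where
  go : A → A → A → A → A → A → Bool
  go u v w x y z = R u v ∧ R v w ∧ R w x ∧ R x y ∧ R y z ∧ R z u

gentle : (Region → Form) → Chart → Bool
gentle f χ = cyclic near (λ t → valueAt f (slotOf χ t))

_≟ʳ_ : DecidableEquality Region
_≟ʳ_ = ≡-dec Fin._≟_ Fin._≟_

_≟ˢ_ : DecidableEquality (Region × Mode)
_≟ˢ_ = ≡-dec _≟ʳ_ Fin._≟_

prev : Fin 6 → Fin 6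
prev t = next (next (next (next (next t))))

beyond : Region → Maybe (Piece × Fin 6)
beyond (k , b) = lookup otherFace b

-- Splits a region at i = 0, where a vertex is seen on the first hexagon of the piece, and i ≥ 1,
-- where it is seen on a later one; `endCover` splits at j in the same way. The predicate is a
-- parameter because `occupies` (the region sits there) and `sinks` (a neighbour there is lower) are
-- checked separately and combined afterwards.
startCover : (Chart → Fin 6 → Mode → Bool) → Region → Piece → Fin 6 → Bool
startCover p r@(k , _) π t =
  p (k , π , false) t start ∧ (not (long (homePiece r)) ∨ p (k , π , true) t fore)

endCover : (Chart → Fin 6 → Mode → Bool) → Region → Piece → Fin 6 → Bool
endCover p r@(k , _) π t =
  p (k , π , false) t end ∧ p (k , homePiece r , true) t back

homeCover : (Chart → Fin 6 → Mode → Bool) → Region → Bool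
homeCover p r = startCover p r (homePiece r) (homeCorner r)

beyondCover : (Chart → Fin 6 → Mode → Bool) → Region → Maybe (Piece × Fin 6) → Bool
beyondCover p r nothing        = false
beyondCover p r (just (π , t)) = if long (homePiece r) then endCover p r π t else startCover p r π t

occupies : Region → Chart → Fin 6 → Mode → Bool
occupies r χ t m = does (slotOf χ t ≟ˢ (r , m))

covered : Region → Bool
covered r = homeCover (occupies r) r ∧ (is-nothing (beyond r) ∨ beyondCover (occupies r) r (beyond r))

sinks : (Region → Form) → Region → Chart → Fin 6 → Mode → Bool
sinks f r χ t m = lower (inst m (extent r) (f r))
  where
  lower : Form → Bool
  lower F = (num 1 ⊞ valueAt f (slotOf χ (next t)) ≤ᶠ F) ∨ (num 1 ⊞ valueAt f (slotOf χ (prev t)) ≤ᶠ F)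

-- One face has to serve the whole region, but the direction of descent along it may differ between
-- the extreme vertex and the others.
descends : Region → (Region → Form) → Region → Bool
descends o f r = does (r ≟ʳ o) ∨ homeCover (sinks f r) r ∨ beyondCover (sinks f r) r (beyond r)

sources : List Source
sources = cartesianProduct (allFin 3) (allFin 11)

-- Separating regions by linear functionals

record Bound : Set where
  constructor bound
  field k₀ k₁ k₂ k₃ : ℤ

dot : ∀ {n} → Vec ℤ n → Vec ℕ n → ℤ
dot []       []       = 0ℤ
dot (w ∷ ws) (v ∷ vs) = w ℤ.* (ℤ.+ v) ℤ.+ dot ws vs

raise : Span → ℤ → Bound → Bound
raise nothing   m (bound k x y z) = bound k x y z
raise (just 0F) m (bound k x y z) = bound k (x ℤ.+ m) y z
raise (just 1F) m (bound k x y z) = bound k x (y ℤ.+ m) z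
raise (just 2F) m (bound k x y z) = bound k x y (z ℤ.+ m)

-- Upper bound of a functional on a region: it is affine in i, hence maximal at an
-- end of the region.
upper : ∀ {n} → Span → Vec ℤ n → Vec Form n → Bound
upper s w Fs =
  raise s (dot w (Vec.map ci Fs) ℤ.⊔ dot w (Vec.map cj Fs))
    (bound (dot w (Vec.map const Fs)) (dot w (Vec.map ca Fs)) (dot w (Vec.map cb Fs)) (dot w (Vec.map cc Fs)))

-- Since a, b, c are natural numbers, nonpositive coefficients and a constant of at most -1 keep the
-- sum below 0 for all of them.
negative : Bound → Bound → Bool
negative (bound k x y z) (bound k′ x′ y′ z′) =
  (k ℤ.+ k′ ℤ.≤ᵇ -1ℤ) ∧ (x ℤ.+ x′ ℤ.≤ᵇ 0ℤ) ∧ (y ℤ.+ y′ ℤ.≤ᵇ 0ℤ) ∧ (z ℤ.+ z′ ℤ.≤ᵇ 0ℤ)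

-- To separate two regions by w, the largest value of w on one must lie below the smallest on the
-- other; the smallest value is minus the largest of -w, so both maxima are recorded.
profile : ∀ {n} → List (Vec ℤ n) → Span → Vec Form n → List (Bound × Bound)
profile ws s Fs = map (λ w → upper s w Fs , upper s (Vec.map ℤ.-_ w) Fs) ws

apart : List (Bound × Bound) → List (Bound × Bound) → Bool
apart ((u , v) ∷ us) ((u′ , v′) ∷ us′) = negative u v′ ∨ negative v u′ ∨ apart us us′
apart _              _                = false

sloped : ∀ {n} → Vec Form n → Bool
sloped []       = false
sloped (F ∷ Fs) = not (ci F ≡ᵇ cj F) ∨ sloped Fs

allPairs : ∀ {A : Set} → (A → A → Bool) → List A → Bool
allPairs R xs = all (λ x → all (R x) xs) xs

Entry : Set
Entry = Region × Bool × List (Bound × Bound)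

-- Within one region it suffices that some form recovers i, which is possible when its coefficients
-- of i and j differ; different regions need a separating functional.
discern : Entry → Entry → Bool
discern (r , b , P) (r′ , _ , P′) = if does (r ≟ʳ r′) then b else apart P P′

entry : ∀ {n} → List (Vec ℤ n) → (Region → Vec Form n) → Region → Entry
entry ws f r = r , (is-nothing (extent r) ∨ sloped (f r)) , profile ws (extent r) (f r)

injectiveCheck : ∀ {n} → List (Vec ℤ n) → (Region → Vec Form n) → Bool
injectiveCheck ws f = allPairs discern (map (entry ws f) regions)

-- Apart from the colour these are x, y and x + y, which are constant along the three directions of
-- the chains.
posFunctionals : List (Vec ℤ 3)
posFunctionals =
  (1ℤ ∷ 0ℤ ∷ 0ℤ ∷ []) ∷ (0ℤ ∷ 1ℤ ∷ 0ℤ ∷ []) ∷ (0ℤ ∷ 0ℤ ∷ 1ℤ ∷ []) ∷ (1ℤ ∷ 1ℤ ∷ 0ℤ ∷ []) ∷ []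

landmark : Sector → Source
landmark k = k , # 5

landmarkᶠ : Region → Vec Form 4
landmarkᶠ r = lookup (posᶠ r) 2F ∷ distᶠ (landmark 0F) r ∷ distᶠ (landmark 1F) r ∷ distᶠ (landmark 2F) r ∷ []

-- On a long region each landmark distance has slope 2 in exactly one of i and j, so for any two
-- landmarks the sum or the difference is constant along the region. The first functional separates
-- regions of different colours outright and leaves only those of equal colour to the distances.
landmarkFunctionals : List (Vec ℤ 4)
landmarkFunctionals =
  (1ℤ ∷ 0ℤ ∷ 0ℤ ∷ 0ℤ ∷ []) ∷ (0ℤ ∷ 1ℤ ∷ 0ℤ ∷ 0ℤ ∷ []) ∷
  (0ℤ ∷ 0ℤ ∷ 1ℤ ∷ 0ℤ ∷ []) ∷ (0ℤ ∷ 0ℤ ∷ 0ℤ ∷ 1ℤ ∷ []) ∷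
  (0ℤ ∷ 1ℤ ∷ 1ℤ ∷ 0ℤ ∷ []) ∷ (0ℤ ∷ 1ℤ ∷ 0ℤ ∷ 1ℤ ∷ []) ∷
  (0ℤ ∷ 0ℤ ∷ 1ℤ ∷ 1ℤ ∷ []) ∷ (0ℤ ∷ 1ℤ ∷ -1ℤ ∷ 0ℤ ∷ []) ∷
  (0ℤ ∷ 1ℤ ∷ 0ℤ ∷ -1ℤ ∷ []) ∷ (0ℤ ∷ 0ℤ ∷ 1ℤ ∷ -1ℤ ∷ []) ∷ []

-- In the first nine pairs the two vertices have a common neighbour; in the last four they are at
-- distance 4. Thus both have the same colour, without which no vertex could be equidistant from
-- them.
twins₀ : List (Source × Source)
twins₀ =
  ((0F , # 5) , (0F , # 8))  ∷ ((0F , # 6) , (0F , # 10)) ∷ ((0F , # 3) , (0F , # 9))  ∷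
  ((0F , # 4) , (0F , # 7))  ∷ ((0F , # 0) , (1F , # 0))  ∷ ((0F , # 4) , (0F , # 8))  ∷
  ((0F , # 3) , (0F , # 10)) ∷ ((0F , # 7) , (0F , # 8))  ∷ ((0F , # 9) , (0F , # 10)) ∷
  ((0F , # 1) , (0F , # 6))  ∷ ((0F , # 2) , (0F , # 5))  ∷ ((0F , # 2) , (0F , # 7))  ∷
  ((0F , # 1) , (0F , # 9))  ∷ []

twins : List (Source × Source)
twins = cartesianProductWith (λ k ((k₁ , s₁) , (k₂ , s₂)) → (k ⊕ k₁ , s₁) , (k ⊕ k₂ , s₂)) (allFin 3) twins₀

confused : Region → Source × Source → Bool
confused r (s , s′) = distᶠ s r ≡ᶠ distᶠ s′ r

distinct : Source × Source → Bool
distinct (s , s′) = 1 ≤ᵇ const (distᶠ s (site s′))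

meet : List Bool → List Bool → Bool
meet (b ∷ bs) (b′ ∷ bs′) = (b ∧ b′) ∨ meet bs bs′
meet _        _          = false

signature : Region → List Bool
signature r = map (confused r) twins

-- The checks

-- This check and the following ones evaluate closed terms. The side lengths enter only through
-- coefficients, so one evaluation covers all of them.
atlas : allCharts wellPlaced ≡ true
atlas = refl

-- Independent of any source: the faces named by `owner` and `otherFace` really show the region in
-- the slots where descent is tested.
coverage : all covered regions ≡ true
coverage = refl

anchored : all (λ s → is-nothing (extent (site s))) sources ≡ true
anchored = refl

vanishing : all (λ s → distᶠ s (site s) ≡ᶠ num 0) sources ≡ true
vanishing = refl

gentleness : all (λ s → allCharts (gentle (distᶠ s))) sources ≡ true
gentleness = refl

descending : all (λ s → all (descends (site s) (distᶠ s)) regions) sources ≡ true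
descending = refl

-- Makes the code of a vertex unique, so that a family of forms defines a function on vertices.
positions : injectiveCheck posFunctionals posᶠ ≡ true
positions = refl

landmarks : injectiveCheck landmarkFunctionals landmarkᶠ ≡ true
landmarks = refl

twins-distinct : all distinct twins ≡ true
twins-distinct = refl

-- Two prospective landmarks matter only through their regions, so finitely many pairs of regions
-- decide the lower bound.
twins-meet : allPairs meet (map signature regions) ≡ true
twins-meet = refl

-- The hexagons of FCS

slack : ∀ {m n} d → m + d ≡ n → m ≤ n
slack d refl = m≤m+n _ d

private
  weakenˡ : ∀ b c {u} → u ≤ 3 + b → u ≤ 2 + (b + (4 + c))
  weakenˡ b c u≤ = ≤-trans u≤ (slack (3 + c) (eq b c))
    where
    eq : ∀ b c → 3 + b + (3 + c) ≡ 2 + (b + (4 + c))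
    eq = solve-∀

  weakenʳ : ∀ b c {u} → u ≤ 3 + c → u ≤ 2 + (b + (4 + c))
  weakenʳ b c u≤ = ≤-trans u≤ (slack (3 + b) (eq b c))
    where
    eq : ∀ b c → 3 + c + (3 + b) ≡ 2 + (b + (4 + c))
    eq = solve-∀

  shiftˡ : ∀ a c {u} → u ≤ 3 + c → 3 + (a + u) ≤ 2 + (a + (4 + c))
  shiftˡ a c u≤ = ≤-trans (+-monoʳ-≤ 3 (+-monoʳ-≤ a u≤)) (≤-reflexive (eq a c))
    where
    eq : ∀ a c → 3 + (a + (3 + c)) ≡ 2 + (a + (4 + c))
    eq = solve-∀

  shiftʳ : ∀ a c {u} → u ≤ 3 + a → 3 + (c + u) ≤ 2 + (a + (4 + c))
  shiftʳ a c u≤ = ≤-trans (+-monoʳ-≤ 3 (+-monoʳ-≤ c u≤)) (≤-reflexive (eq a c))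
    where
    eq : ∀ a c → 3 + (c + (3 + a)) ≡ 2 + (a + (4 + c))
    eq = solve-∀

  sumˡ : ∀ a b c {u} → u ≤ 3 + b → 2 + (a + (4 + c)) + u ≤ suc (a + (4 + b) + (4 + c))
  sumˡ a b c u≤ = ≤-trans (+-monoʳ-≤ (2 + (a + (4 + c))) u≤) (≤-reflexive (eq a b c))
    where
    eq : ∀ a b c → 2 + (a + (4 + c)) + (3 + b) ≡ suc (a + (4 + b) + (4 + c))
    eq = solve-∀

  sumʳ : ∀ a b c {u} → u ≤ 3 + a → u + (2 + (b + (4 + c))) ≤ suc (a + (4 + b) + (4 + c))
  sumʳ a b c u≤ = ≤-trans (+-monoˡ-≤ (2 + (b + (4 + c))) u≤) (≤-reflexive (eq a b c))
    where
    eq : ∀ a b c → 3 + a + (2 + (b + (4 + c))) ≡ suc (a + (4 + b) + (4 + c))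
    eq = solve-∀

  total : ∀ a b c → 3 + a + (3 + b) + (3 + c) ≡ suc (a + (4 + b) + (4 + c))
  total = solve-∀

  outer : ∀ a b c {m} d → m + d ≡ 3 + a + (3 + b) + (3 + c) → m ≤ suc (a + (4 + b) + (4 + c))
  outer a b c d e = slack d (trans e (total a b c))

  right-sum : ∀ a b c {J J*} → J + J* ≡ 3 + c → 3 + (a + J*) + (3 + (b + J)) ≡ suc (a + (4 + b) + (4 + c))
  right-sum a b c {J} {J*} h =
    trans (eq a b J J*) (trans (cong (3 + a + (3 + b) +_) h) (total a b c))
    where
    eq : ∀ a b J J* → 3 + (a + J*) + (3 + (b + J)) ≡ 3 + a + (3 + b) + (J + J*)
    eq = solve-∀

  arm-sum : ∀ b c {J J*} → J + J* ≡ 2 + c → 1 + J* + (3 + (b + J)) ≡ 2 + (b + (4 + c))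
  arm-sum b c {J} {J*} h = trans (eq b J J*) (trans (cong (4 + b +_) h) (eq′ b c))
    where
    eq : ∀ b J J* → 1 + J* + (3 + (b + J)) ≡ 4 + b + (J + J*)
    eq = solve-∀
    eq′ : ∀ b c → 4 + b + (2 + c) ≡ 2 + (b + (4 + c))
    eq′ = solve-∀

  inner : ∀ a b c → 3 + c ≤ suc (a + (4 + b) + (4 + c))
  inner a b c = outer a b c (3 + a + (3 + b)) (+-comm (3 + c) (3 + a + (3 + b)))

  corner-sum : ∀ a b c {u} → u ≤ 3 + a → 3 + (c + u) ≤ suc (a + (4 + b) + (4 + c))
  corner-sum a b c u≤ = ≤-trans (+-monoʳ-≤ 3 (+-monoʳ-≤ c u≤)) (outer a b c (3 + b) (eq a b c))
    where
    eq : ∀ a b c → 3 + (c + (3 + a)) + (3 + b) ≡ 3 + a + (3 + b) + (3 + c)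
    eq = solve-∀

  corner-sum′ : ∀ a b c {u} → u ≤ 3 + b → 3 + (c + u) ≤ suc (a + (4 + b) + (4 + c))
  corner-sum′ a b c u≤ = ≤-trans (+-monoʳ-≤ 3 (+-monoʳ-≤ c u≤)) (outer a b c (3 + a) (eq a b c))
    where
    eq : ∀ a b c → 3 + (c + (3 + b)) + (3 + a) ≡ 3 + a + (3 + b) + (3 + c)
    eq = solve-∀

  arm-bound : ∀ a c {u} → u ≤ 2 + a → 3 + (c + u) ≤ suc (a + (4 + c))
  arm-bound a c u≤ = ≤-trans (+-monoʳ-≤ 3 (+-monoʳ-≤ c u≤)) (≤-reflexive (eq a c))
    where
    eq : ∀ a c → 3 + (c + (2 + a)) ≡ suc (a + (4 + c))
    eq = solve-∀

  low-side : ∀ a c u → 3 + c ≤ 2 + (a + (4 + c)) + u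
  low-side a c u = slack (3 + a + u) (eq a c u)
    where
    eq : ∀ a c u → 3 + c + (3 + a + u) ≡ 2 + (a + (4 + c)) + u
    eq = solve-∀

  cut-0-right : ∀ b c J J* → 3 + c + J* + J ≡ 2 + (b + (4 + c)) → J + J* ≡ 3 + b
  cut-0-right b c J J* e = +-cancelˡ-≡ (3 + c) _ _ (trans (eq c J J*) (trans e (eq′ b c)))
    where
    eq : ∀ c J J* → 3 + c + (J + J*) ≡ 3 + c + J* + J
    eq = solve-∀
    eq′ : ∀ b c → 2 + (b + (4 + c)) ≡ 3 + c + (3 + b)
    eq′ = solve-∀

  cut-left : ∀ a b c J J* → 2 + (a + (4 + c)) + J* + J ≡ suc (a + (4 + b) + (4 + c)) → J + J* ≡ 3 + b
  cut-left a b c J J* e = +-cancelˡ-≡ (2 + (a + (4 + c))) _ _ (trans (eq a c J J*) (trans e (eq′ a b c)))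
    where
    eq : ∀ a c J J* → 2 + (a + (4 + c)) + (J + J*) ≡ 2 + (a + (4 + c)) + J* + J
    eq = solve-∀
    eq′ : ∀ a b c → suc (a + (4 + b) + (4 + c)) ≡ 2 + (a + (4 + c)) + (3 + b)
    eq′ = solve-∀

  cut-left′ : ∀ a b c J J* → J + (2 + (b + (4 + c))) + J* ≡ suc (a + (4 + b) + (4 + c)) → J + J* ≡ 3 + a
  cut-left′ a b c J J* e = +-cancelˡ-≡ (2 + (b + (4 + c))) _ _ (trans (eq b c J J*) (trans e (eq′ a b c)))
    where
    eq : ∀ b c J J* → 2 + (b + (4 + c)) + (J + J*) ≡ J + (2 + (b + (4 + c))) + J*
    eq = solve-∀
    eq′ : ∀ a b c → suc (a + (4 + b) + (4 + c)) ≡ 2 + (b + (4 + c)) + (3 + a)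
    eq′ = solve-∀

  cut-arm : ∀ a c J J* → 3 + c + J + J* ≡ suc (a + (4 + c)) → J + J* ≡ 2 + a
  cut-arm a c J J* e = +-cancelˡ-≡ (3 + c) _ _ (trans (eq c J J*) (trans e (eq′ a c)))
    where
    eq : ∀ c J J* → 3 + c + (J + J*) ≡ 3 + c + J + J*
    eq = solve-∀
    eq′ : ∀ a c → suc (a + (4 + c)) ≡ 3 + c + (2 + a)
    eq′ = solve-∀

  cut-right : ∀ a b c q r J* → q + r ≡ suc (a + (4 + b) + (4 + c)) → r + J* ≡ 2 + (b + (4 + c)) → q ≡ 3 + (a + J*)
  cut-right a b c q r J* e f = +-cancelˡ-≡ r _ _
    (trans (+-comm r q) (trans e (trans (eq a b c) (trans (cong (3 + a +_) (sym f)) (eq′ a r J*)))))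
    where
    eq : ∀ a b c → suc (a + (4 + b) + (4 + c)) ≡ 3 + a + (2 + (b + (4 + c)))
    eq = solve-∀
    eq′ : ∀ a r J* → 3 + a + (r + J*) ≡ r + (3 + (a + J*))
    eq′ = solve-∀

  cut-right-size : ∀ a c J J* → 3 + (a + J*) + J ≡ 2 + (a + (4 + c)) → J + J* ≡ 3 + c
  cut-right-size a c J J* e = +-cancelˡ-≡ (3 + a) _ _ (trans (eq a J J*) (trans e (eq′ a c)))
    where
    eq : ∀ a J J* → 3 + a + (J + J*) ≡ 3 + (a + J*) + J
    eq = solve-∀
    eq′ : ∀ a c → 2 + (a + (4 + c)) ≡ 3 + a + (3 + c)
    eq′ = solve-∀

  complement : ∀ b s r J J* → J + J* ≡ s → r + J* ≡ 3 + b + s → r ≡ 3 + (b + J)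
  complement b s r J J* h e = +-cancelʳ-≡ J* _ _ (trans e (trans (cong (3 + b +_) (sym h)) (eq b J J*)))
    where
    eq : ∀ b J J* → 3 + b + (J + J*) ≡ 3 + (b + J) + J*
    eq = solve-∀

  regroup : ∀ b c → 2 + (b + (4 + c)) ≡ 3 + b + (3 + c)
  regroup = solve-∀

module Nodes (a b c : ℕ) where

  Hexagon : ℕ → ℕ → Set
  Hexagon q r = T (fcsHex (4 + a) (4 + b) (4 + c) (suc q) (suc r))

  par : Sector → ℕ
  par 0F = a
  par 1F = b
  par 2F = c

  node : Sector → Chain → ℕ → ℕ → ℕ × ℕ
  node 0F armᶜ   J J* = 3 + (c + J)       , 3 + b
  node 0F leftᶜ  J J* = 2 + (a + (4 + c)) , J*
  node 0F rightᶜ J J* = 3 + (a + J*)      , 3 + (b + J)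
  node 1F armᶜ   J J* = 3 + c             , 1 + J*
  node 1F leftᶜ  J J* = J*                , J
  node 1F rightᶜ J J* = 3 + (c + J)       , 0
  node 2F armᶜ   J J* = 1 + J*            , 3 + (b + J)
  node 2F leftᶜ  J J* = J                 , 2 + (b + (4 + c))
  node 2F rightᶜ J J* = 0                 , 3 + (c + J*)

  size : Sector → Chain → ℕ
  size k armᶜ = 2 + par (axis k armᶜ)
  size k ch   = 3 + par (axis k ch)

  private
    ring-intro : ∀ q r → q ≤ 2 + (a + (4 + c)) → r ≤ 2 + (b + (4 + c)) → 3 + c ≤ q + r →
      q + r ≤ suc (a + (4 + b) + (4 + c)) →
      T ((q ≡ᵇ 0) ∨ (q ≡ᵇ 2 + (a + (4 + c))) ∨ (r ≡ᵇ 0) ∨ (r ≡ᵇ 2 + (b + (4 + c))) ∨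
         (q + r ≡ᵇ 3 + c) ∨ (q + r ≡ᵇ suc (a + (4 + b) + (4 + c)))) → Hexagon q r
    ring-intro q r q≤ r≤ ≤s s≤ side = from T-∨ (inj₁
      (from T-∧ (≤⇒≤ᵇ q≤ , from T-∧ (≤⇒≤ᵇ r≤ , from T-∧ (≤⇒≤ᵇ ≤s , from T-∧ (≤⇒≤ᵇ s≤ , side))))))

    star-intro : ∀ q r →
      T (((r ≡ᵇ 3 + b) ∧ ((3 + c) ≤ᵇ q) ∧ (q ≤ᵇ suc (a + (4 + c)))) ∨
         ((q ≡ᵇ (3 + c)) ∧ (1 ≤ᵇ r) ∧ (r ≤ᵇ 3 + b)) ∨
         ((q + r ≡ᵇ (2 + (b + (4 + c)))) ∧ (1 ≤ᵇ q) ∧ (q ≤ᵇ (3 + c)))) → Hexagon q r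
    star-intro q r = λ t → from (T-∨ {ringHex (4 + a) (4 + b) (4 + c) q r}) (inj₂ t)

    ∨₁ : ∀ {x y} → T x → T (x ∨ y)
    ∨₁ t = from T-∨ (inj₁ t)
    ∨₂ : ∀ {x y} → T y → T (x ∨ y)
    ∨₂ {x} t = from (T-∨ {x}) (inj₂ t)

    eq : ∀ {m n} → m ≡ n → T (m ≡ᵇ n)
    eq = ≡⇒≡ᵇ _ _

    fst≤ : ∀ {J J* s} → J + J* ≡ s → J ≤ s
    fst≤ {J} refl = m≤m+n J _

    snd≤ : ∀ {J J* s} → J + J* ≡ s → J* ≤ s
    snd≤ {J} refl = m≤n+m _ J

  node-present : ∀ k ch J J* → J + J* ≡ size k ch →
    Hexagon (proj₁ (node k ch J J*)) (proj₂ (node k ch J J*))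
  node-present 0F armᶜ J J* h = star-intro (3 + (c + J)) (3 + b)
    (∨₁ {(b ≡ᵇ b) ∧ (3 + c ≤ᵇ 3 + (c + J)) ∧ (3 + (c + J) ≤ᵇ suc (a + (4 + c)))}
      (from T-∧ (eq {b} refl , from T-∧ (≤⇒≤ᵇ (m≤m+n (3 + c) J) , ≤⇒≤ᵇ (arm-bound a c (fst≤ h))))))
  node-present 0F leftᶜ J J* h = ring-intro (2 + (a + (4 + c))) J* ≤-refl
    (weakenˡ b c (snd≤ h)) (low-side a c J*) (sumˡ a b c (snd≤ h))
    (∨₂ {2 + (a + (4 + c)) ≡ᵇ 0} (∨₁ (eq {2 + (a + (4 + c))} refl)))
  node-present 0F rightᶜ J J* h = ring-intro (3 + (a + J*)) (3 + (b + J))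
    (shiftˡ a c (snd≤ h)) (shiftˡ b c (fst≤ h))
    (≤-trans (inner a b c) (≤-reflexive (sym (right-sum a b c h)))) (≤-reflexive (right-sum a b c h))
    (∨₂ {3 + (a + J*) ≡ᵇ 0} (∨₂ {3 + (a + J*) ≡ᵇ 2 + (a + (4 + c))} (∨₂ {3 + (b + J) ≡ᵇ 0}
      (∨₂ {3 + (b + J) ≡ᵇ 2 + (b + (4 + c))} (∨₂ {3 + (a + J*) + (3 + (b + J)) ≡ᵇ 3 + c}
        (eq {3 + (a + J*) + (3 + (b + J))} (right-sum a b c h)))))))
  node-present 1F armᶜ J J* h = star-intro (3 + c) (1 + J*)
    (∨₂ {(J* ≡ᵇ 2 + b) ∧ (3 + c ≤ᵇ 3 + c) ∧ (3 + c ≤ᵇ suc (a + (4 + c)))} (∨₁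
      (from T-∧ (eq {3 + c} refl , from (T-∧ {1 ≤ᵇ suc J*}) (tt , ≤⇒≤ᵇ (s≤s (snd≤ {J} {J*} h)))))))
  node-present 1F leftᶜ J J* h = ring-intro J* J
    (weakenʳ a c (snd≤ h)) (weakenʳ b c (fst≤ h))
    (≤-reflexive (sym sum)) (≤-trans (≤-reflexive sum) (inner a b c))
    (∨₂ {J* ≡ᵇ 0} (∨₂ {J* ≡ᵇ 2 + (a + (4 + c))} (∨₂ {J ≡ᵇ 0} (∨₂ {J ≡ᵇ 2 + (b + (4 + c))} (∨₁ (eq {J* + J} sum))))))
    where
    sum : J* + J ≡ 3 + c
    sum = trans (+-comm J* J) h
  node-present 1F rightᶜ J J* h = ring-intro (3 + (c + J)) 0
    (shiftʳ a c (fst≤ h)) z≤n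
    (≤-trans (m≤m+n (3 + c) J) (≤-reflexive (sym (+-identityʳ (3 + (c + J))))))
    (≤-trans (≤-reflexive (+-identityʳ (3 + (c + J)))) (corner-sum a b c (fst≤ h)))
    (∨₂ {3 + (c + J) ≡ᵇ 0} (∨₂ {3 + (c + J) ≡ᵇ 2 + (a + (4 + c))} tt))
  node-present 2F armᶜ J J* h = star-intro (1 + J*) (3 + (b + J))
    (∨₂ {(b + J ≡ᵇ b) ∧ (3 + c ≤ᵇ 1 + J*) ∧ (1 + J* ≤ᵇ suc (a + (4 + c)))}
      (∨₂ {(1 + J* ≡ᵇ 3 + c) ∧ (1 ≤ᵇ 3 + (b + J)) ∧ (3 + (b + J) ≤ᵇ 3 + b)}
        (from (T-∧ {1 + J* + (3 + (b + J)) ≡ᵇ 2 + (b + (4 + c))}) (eq {1 + J* + (3 + (b + J))} (arm-sum b c h) ,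
          from (T-∧ {1 ≤ᵇ suc J*}) (tt , ≤⇒≤ᵇ (s≤s (snd≤ {J} {J*} h)))))))
  node-present 2F leftᶜ J J* h = ring-intro J (2 + (b + (4 + c)))
    (weakenˡ a c (fst≤ h)) ≤-refl
    (≤-trans (weakenʳ b c ≤-refl) (m≤n+m _ J)) (sumʳ a b c (fst≤ h))
    (∨₂ {J ≡ᵇ 0} (∨₂ {J ≡ᵇ 2 + (a + (4 + c))} (∨₂ {2 + (b + (4 + c)) ≡ᵇ 0} (∨₁ (eq {2 + (b + (4 + c))} refl)))))
  node-present 2F rightᶜ J J* h = ring-intro 0 (3 + (c + J*)) z≤n
    (shiftʳ b c (snd≤ h)) (m≤m+n (3 + c) J*) (corner-sum′ a b c (snd≤ h)) tt

  Located : ℕ → ℕ → Set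
  Located q r = ∃[ k ] ∃[ ch ] ∃[ J ] ∃[ J* ] (J + J* ≡ size k ch × (q , r) ≡ node k ch J J*)

  private
    -- Each of the six boundary equations selects one side of the coronoid. The two inequalities
    -- that are equalities at its ends have slacks J and J*; where the bound is 0 ≤ q or 0 ≤ r the
    -- slack is the coordinate itself.
    ring-located : ∀ q r → q ≤ 2 + (a + (4 + c)) → r ≤ 2 + (b + (4 + c)) → 3 + c ≤ q + r →
      q + r ≤ suc (a + (4 + b) + (4 + c)) →
      T ((q ≡ᵇ 0) ∨ (q ≡ᵇ 2 + (a + (4 + c))) ∨ (r ≡ᵇ 0) ∨ (r ≡ᵇ 2 + (b + (4 + c))) ∨
         (q + r ≡ᵇ 3 + c) ∨ (q + r ≡ᵇ suc (a + (4 + b) + (4 + c)))) → Located q r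
    ring-located q r q≤ r≤ ≤s s≤ side with to (T-∨ {q ≡ᵇ 0}) side
    ... | inj₁ q≡0 with refl ← ≡ᵇ⇒≡ q 0 q≡0
                      with (J* , refl) ← m≤n⇒∃[o]m+o≡n ≤s
                      with (J , e) ← m≤n⇒∃[o]m+o≡n r≤ =
      2F , rightᶜ , J , J* , cut-0-right b c J J* e , refl
    ... | inj₂ side with to (T-∨ {q ≡ᵇ 2 + (a + (4 + c))}) side
    ... | inj₁ q≡Q with refl ← ≡ᵇ⇒≡ q (2 + (a + (4 + c))) q≡Q
                      with (J , e) ← m≤n⇒∃[o]m+o≡n s≤ =
      0F , leftᶜ , J , r , cut-left a b c J r e , refl
    ... | inj₂ side with to (T-∨ {r ≡ᵇ 0}) side
    ... | inj₁ r≡0 with refl ← ≡ᵇ⇒≡ r 0 r≡0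
                      with (J , e) ← m≤n⇒∃[o]m+o≡n (≤-trans ≤s (≤-reflexive (+-identityʳ q)))
                      with (J* , f) ← m≤n⇒∃[o]m+o≡n q≤ =
      1F , rightᶜ , J , J* ,
      trans (+-comm J J*) (cut-0-right a c J* J (trans (cong (_+ J*) e) f)) , cong (_, 0) (sym e)
    ... | inj₂ side with to (T-∨ {r ≡ᵇ 2 + (b + (4 + c))}) side
    ... | inj₁ r≡R with refl ← ≡ᵇ⇒≡ r (2 + (b + (4 + c))) r≡R
                      with (J* , e) ← m≤n⇒∃[o]m+o≡n s≤ =
      2F , leftᶜ , q , J* , cut-left′ a b c q J* e , refl
    ... | inj₂ side with to (T-∨ {q + r ≡ᵇ 3 + c}) side
    ... | inj₁ s≡S = 1F , leftᶜ , r , q , trans (+-comm r q) (≡ᵇ⇒≡ (q + r) (3 + c) s≡S) , refl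
    ... | inj₂ s≡N with (J* , e) ← m≤n⇒∃[o]m+o≡n r≤
                      with refl ← cut-right a b c q r J* (≡ᵇ⇒≡ (q + r) (suc (a + (4 + b) + (4 + c))) s≡N) e
                      with (J , f) ← m≤n⇒∃[o]m+o≡n q≤ =
      0F , rightᶜ , J , J* , size≡ ,
      cong (3 + (a + J*) ,_) (complement b (3 + c) r J J* size≡ (trans e (regroup b c)))
      where
      size≡ = cut-right-size a c J J* f

    star-located : ∀ q r →
      T (((r ≡ᵇ 3 + b) ∧ (3 + c ≤ᵇ q) ∧ (q ≤ᵇ suc (a + (4 + c)))) ∨
         ((q ≡ᵇ 3 + c) ∧ (1 ≤ᵇ r) ∧ (r ≤ᵇ 3 + b)) ∨
         ((q + r ≡ᵇ 2 + (b + (4 + c))) ∧ (1 ≤ᵇ q) ∧ (q ≤ᵇ 3 + c))) → Located q r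
    star-located q r t with to (T-∨ {(r ≡ᵇ 3 + b) ∧ (3 + c ≤ᵇ q) ∧ (q ≤ᵇ suc (a + (4 + c)))}) t
    ... | inj₁ t with (r≡ , t) ← to (T-∧ {r ≡ᵇ 3 + b}) t
                 with (≤q , q≤) ← to (T-∧ {3 + c ≤ᵇ q}) t
                 with refl ← ≡ᵇ⇒≡ r (3 + b) r≡
                    with (J , refl) ← m≤n⇒∃[o]m+o≡n (≤ᵇ⇒≤ (3 + c) q ≤q)
                 with (J* , e) ← m≤n⇒∃[o]m+o≡n (≤ᵇ⇒≤ (3 + c + J) (suc (a + (4 + c))) q≤) =
      0F , armᶜ , J , J* , cut-arm a c J J* e , refl
    ... | inj₂ t with to (T-∨ {(q ≡ᵇ 3 + c) ∧ (1 ≤ᵇ r) ∧ (r ≤ᵇ 3 + b)}) t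
    ... | inj₁ t with (q≡ , t) ← to (T-∧ {q ≡ᵇ 3 + c}) t
                 with (≤r , r≤) ← to (T-∧ {1 ≤ᵇ r}) t
                 with refl ← ≡ᵇ⇒≡ q (3 + c) q≡
                    with (J* , refl) ← m≤n⇒∃[o]m+o≡n (≤ᵇ⇒≤ 1 r ≤r)
                 with (J , e) ← m≤n⇒∃[o]m+o≡n (≤ᵇ⇒≤ (1 + J*) (3 + b) r≤) =
      1F , armᶜ , J , J* , trans (+-comm J J*) (suc-injective e) , refl
    ... | inj₂ t with (s≡ , t) ← to (T-∧ {q + r ≡ᵇ 2 + (b + (4 + c))}) t
                 with (≤q , q≤) ← to (T-∧ {1 ≤ᵇ q}) t
                 with (J* , refl) ← m≤n⇒∃[o]m+o≡n (≤ᵇ⇒≤ 1 q ≤q)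
                 with (J , e) ← m≤n⇒∃[o]m+o≡n (≤ᵇ⇒≤ (1 + J*) (3 + c) q≤) =
      2F , armᶜ , J , J* , size≡ ,
      cong (1 + J* ,_) (complement b (2 + c) r J J* size≡
        (trans (+-comm r J*) (suc-injective (trans (≡ᵇ⇒≡ (1 + J* + r) (2 + (b + (4 + c))) s≡) (regroup′ b c)))))
      where
      size≡ : J + J* ≡ 2 + c
      size≡ = trans (+-comm J J*) (suc-injective e)
      regroup′ : ∀ b c → 2 + (b + (4 + c)) ≡ suc (3 + b + (2 + c))
      regroup′ = solve-∀

  located : ∀ q r → Hexagon q r → Located q r
  located q r t with to (T-∨ {ringHex (4 + a) (4 + b) (4 + c) q r}) t
  ... | inj₂ t = star-located q r t
  ... | inj₁ t with (q≤ , t) ← to (T-∧ {q ≤ᵇ 2 + (a + (4 + c))}) t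
               with (r≤ , t) ← to (T-∧ {r ≤ᵇ 2 + (b + (4 + c))}) t
               with (≤s , t) ← to (T-∧ {3 + c ≤ᵇ q + r}) t
               with (s≤ , t) ← to (T-∧ {q + r ≤ᵇ suc (a + (4 + b) + (4 + c))}) t =
    ring-located q r (≤ᵇ⇒≤ q _ q≤) (≤ᵇ⇒≤ r _ r≤) (≤ᵇ⇒≤ (3 + c) _ ≤s) (≤ᵇ⇒≤ (q + r) _ s≤) t

-- Evaluation of forms

all-true : ∀ {A : Set} (p : A → Bool) {xs x} → all p xs ≡ true → x ∈ xs → p x ≡ true
all-true p {xs} t x∈ = to T-≡ (All.lookup (all⁺ p xs (from T-≡ t)) x∈)

all-∈ : ∀ {A : Set} (p : A → Bool) {xs x} → all p xs ≡ true → x ∈ xs → T (p x)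
all-∈ p t x∈ = from T-≡ (all-true p t x∈)

∈-regions : ∀ r → r ∈ regions
∈-regions (k , b) = ∈-cartesianProduct⁺ (∈-allFin k) (∈-allFin b)

private
  ⊞-eval : ∀ k x y z m n k′ x′ y′ z′ m′ n′ a b c i j →
    k + k′ + (x + x′) * a + (y + y′) * b + (z + z′) * c + (m + m′) * i + (n + n′) * j ≡
    (k + x * a + y * b + z * c + m * i + n * j) + (k′ + x′ * a + y′ * b + z′ * c + m′ * i + n′ * j)
  ⊞-eval = solve-∀

  flat : ∀ k x y z a b c → k + x * a + y * b + z * c + 0 + 0 ≡ k + x * a + y * b + z * c
  flat = solve-∀

  num-eval : ∀ k → k + 0 + 0 + 0 + 0 + 0 ≡ k
  num-eval = solve-∀

  scale₀ : ∀ n a → n * a + 0 + 0 + 0 + 0 ≡ n * a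
  scale₀ = solve-∀
  scale₁ : ∀ n b → n * b + 0 + 0 + 0 ≡ n * b
  scale₁ = solve-∀
  scale₂ : ∀ n c → n * c + 0 + 0 ≡ n * c
  scale₂ = solve-∀

  here₀ : ∀ k x y z m n b c i j → k + x + m + 0 + y * b + z * c + (m + x) * i + (n + x) * j ≡
    k + x * suc (i + j) + y * b + z * c + m * suc i + n * j
  here₀ = solve-∀
  here₁ : ∀ k x y z m n a c i j → k + y + m + x * a + 0 + z * c + (m + y) * i + (n + y) * j ≡
    k + x * a + y * suc (i + j) + z * c + m * suc i + n * j
  here₁ = solve-∀
  here₂ : ∀ k x y z m n a b i j → k + z + m + x * a + y * b + 0 + (m + z) * i + (n + z) * j ≡
    k + x * a + y * b + z * suc (i + j) + m * suc i + n * j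
  here₂ = solve-∀
  back₀ : ∀ k x y z m n b c i j → k + x + n + 0 + y * b + z * c + (m + x) * i + (n + x) * j ≡
    k + x * suc (i + j) + y * b + z * c + m * i + n * suc j
  back₀ = solve-∀
  back₁ : ∀ k x y z m n a c i j → k + y + n + x * a + 0 + z * c + (m + y) * i + (n + y) * j ≡
    k + x * a + y * suc (i + j) + z * c + m * i + n * suc j
  back₁ = solve-∀
  back₂ : ∀ k x y z m n a b i j → k + z + n + x * a + y * b + 0 + (m + z) * i + (n + z) * j ≡
    k + x * a + y * b + z * suc (i + j) + m * i + n * suc j
  back₂ = solve-∀

module Evaluation (a b c : ℕ) where

  open Nodes a b c

  len : Span → ℕ
  len nothing  = 0
  len (just p) = par p

  ⟦_⟧ : Form → ℕ → ℕ → ℕ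
  ⟦ form k x y z m n ⟧ i j = k + x * a + y * b + z * c + m * i + n * j

  ⟦⊞⟧ : ∀ F G i j → ⟦ F ⊞ G ⟧ i j ≡ ⟦ F ⟧ i j + ⟦ G ⟧ i j
  ⟦⊞⟧ (form k x y z m n) (form k′ x′ y′ z′ m′ n′) i j = ⊞-eval k x y z m n k′ x′ y′ z′ m′ n′ a b c i j

  ⟦num⟧ : ∀ k i j → ⟦ num k ⟧ i j ≡ k
  ⟦num⟧ k i j = num-eval k

  ≤ᶠ-sound : ∀ F G i j → T (F ≤ᶠ G) → ⟦ F ⟧ i j ≤ ⟦ G ⟧ i j
  ≤ᶠ-sound (form k x y z m n) (form k′ x′ y′ z′ m′ n′) i j t
    with (k≤ , t) ← to (T-∧ {k ≤ᵇ k′}) t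
    with (x≤ , t) ← to (T-∧ {x ≤ᵇ x′}) t
    with (y≤ , t) ← to (T-∧ {y ≤ᵇ y′}) t
    with (z≤ , t) ← to (T-∧ {z ≤ᵇ z′}) t
    with (m≤ , n≤) ← to (T-∧ {m ≤ᵇ m′}) t =
    +-mono-≤ (+-mono-≤ (+-mono-≤ (+-mono-≤ (+-mono-≤ (≤ᵇ⇒≤ k k′ k≤)
      (*-monoˡ-≤ a (≤ᵇ⇒≤ x x′ x≤))) (*-monoˡ-≤ b (≤ᵇ⇒≤ y y′ y≤))) (*-monoˡ-≤ c (≤ᵇ⇒≤ z z′ z≤)))
      (*-monoˡ-≤ i (≤ᵇ⇒≤ m m′ m≤))) (*-monoˡ-≤ j (≤ᵇ⇒≤ n n′ n≤))

  ≡ᶠ-sound : ∀ F G i j → T (F ≡ᶠ G) → ⟦ F ⟧ i j ≡ ⟦ G ⟧ i j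
  ≡ᶠ-sound F G i j t with (≤ , ≥) ← to (T-∧ {F ≤ᶠ G}) t =
    ≤-antisym (≤ᶠ-sound F G i j ≤) (≤ᶠ-sound G F i j ≥)

  -- What a mode presupposes of i and j. For `start` and `end` they are dummies, as `iAt` and `jAt`
  -- do not depend on them.
  Ready : Mode → Span → ℕ → ℕ → Set
  Ready start s i j = ⊤
  Ready end   s i j = ⊤
  Ready fore  s i j = suc (i + j) ≡ len s
  Ready back  s i j = suc (i + j) ≡ len s

  iAt jAt : Mode → Span → ℕ → ℕ → ℕ
  iAt start s i j = 0
  iAt end   s i j = len s
  iAt fore  s i j = suc i
  iAt back  s i j = i
  jAt start s i j = len s
  jAt end   s i j = 0
  jAt fore  s i j = j
  jAt back  s i j = suc j

  At-sum : ∀ m s i j → Ready m s i j → iAt m s i j + jAt m s i j ≡ len s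
  At-sum start s i j _ = refl
  At-sum end   s i j _ = +-identityʳ (len s)
  At-sum fore  s i j e = e
  At-sum back  s i j e = trans (+-suc i j) e

  ⟦spanForm⟧ : ∀ s n i j → ⟦ spanForm s n ⟧ i j ≡ n * len s
  ⟦spanForm⟧ nothing   n i j = sym (*-zeroʳ n)
  ⟦spanForm⟧ (just 0F) n i j = scale₀ n a
  ⟦spanForm⟧ (just 1F) n i j = scale₁ n b
  ⟦spanForm⟧ (just 2F) n i j = scale₂ n c

  private
    ⟦end⟧ : ∀ k x y z s n i j → ⟦ form k x y z 0 0 ⊞ spanForm s n ⟧ i j ≡ k + x * a + y * b + z * c + n * len s
    ⟦end⟧ k x y z s n i j = trans (⟦⊞⟧ (form k x y z 0 0) (spanForm s n) i j)
      (cong₂ _+_ (flat k x y z a b c) (⟦spanForm⟧ s n i j))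

  -- In modes `fore` and `back` the readiness equation is what allows the spanned parameter to be
  -- replaced by i + j + 1. Without a span it would equate a successor with 0, so those cases are
  -- vacuous.
  inst-sound : ∀ m s F i j → Ready m s i j → ⟦ inst m s F ⟧ i j ≡ ⟦ F ⟧ (iAt m s i j) (jAt m s i j)
  inst-sound start s (form k x y z m n) i j _ = trans (⟦end⟧ k x y z s n i j)
    (cong (_+ n * len s) (sym (trans (cong (k + x * a + y * b + z * c +_) (*-zeroʳ m)) (+-identityʳ _))))
  inst-sound end s (form k x y z m n) i j _ = trans (⟦end⟧ k x y z s m i j)
    (sym (trans (cong (k + x * a + y * b + z * c + m * len s +_) (*-zeroʳ n)) (+-identityʳ _)))
  inst-sound fore (just 0F) (form k x y z m n) i j e =
    trans (here₀ k x y z m n b c i j) (cong (λ p → k + x * p + y * b + z * c + m * suc i + n * j) e)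
  inst-sound fore (just 1F) (form k x y z m n) i j e =
    trans (here₁ k x y z m n a c i j) (cong (λ p → k + x * a + y * p + z * c + m * suc i + n * j) e)
  inst-sound fore (just 2F) (form k x y z m n) i j e =
    trans (here₂ k x y z m n a b i j) (cong (λ p → k + x * a + y * b + z * p + m * suc i + n * j) e)
  inst-sound back (just 0F) (form k x y z m n) i j e =
    trans (back₀ k x y z m n b c i j) (cong (λ p → k + x * p + y * b + z * c + m * i + n * suc j) e)
  inst-sound back (just 1F) (form k x y z m n) i j e =
    trans (back₁ k x y z m n a c i j) (cong (λ p → k + x * a + y * p + z * c + m * i + n * suc j) e)
  inst-sound back (just 2F) (form k x y z m n) i j e =
    trans (back₂ k x y z m n a b i j) (cong (λ p → k + x * a + y * b + z * p + m * i + n * suc j) e)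

  values : ∀ {n} → Vec Form n → ℕ → ℕ → Vec ℕ n
  values Fs i j = Vec.map (λ F → ⟦ F ⟧ i j) Fs

-- Separation by functionals

private
  dot-step : ∀ w k x y z m n K X Y Z M N a b c i j →
    w ℤ.* (k ℤ.+ x ℤ.* a ℤ.+ y ℤ.* b ℤ.+ z ℤ.* c ℤ.+ m ℤ.* i ℤ.+ n ℤ.* j) ℤ.+
      (K ℤ.+ X ℤ.* a ℤ.+ Y ℤ.* b ℤ.+ Z ℤ.* c ℤ.+ M ℤ.* i ℤ.+ N ℤ.* j) ≡
    (w ℤ.* k ℤ.+ K) ℤ.+ (w ℤ.* x ℤ.+ X) ℤ.* a ℤ.+ (w ℤ.* y ℤ.+ Y) ℤ.* b ℤ.+ (w ℤ.* z ℤ.+ Z) ℤ.* c ℤ.+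
      (w ℤ.* m ℤ.+ M) ℤ.* i ℤ.+ (w ℤ.* n ℤ.+ N) ℤ.* j
  dot-step = ℤ-Solver.solve-∀

  raise₀ : ∀ k x y z m a b c → k ℤ.+ (x ℤ.+ m) ℤ.* a ℤ.+ y ℤ.* b ℤ.+ z ℤ.* c ≡
    k ℤ.+ x ℤ.* a ℤ.+ y ℤ.* b ℤ.+ z ℤ.* c ℤ.+ m ℤ.* a
  raise₀ = ℤ-Solver.solve-∀
  raise₁ : ∀ k x y z m a b c → k ℤ.+ x ℤ.* a ℤ.+ (y ℤ.+ m) ℤ.* b ℤ.+ z ℤ.* c ≡
    k ℤ.+ x ℤ.* a ℤ.+ y ℤ.* b ℤ.+ z ℤ.* c ℤ.+ m ℤ.* b
  raise₁ = ℤ-Solver.solve-∀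
  raise₂ : ∀ k x y z m a b c → k ℤ.+ x ℤ.* a ℤ.+ y ℤ.* b ℤ.+ (z ℤ.+ m) ℤ.* c ≡
    k ℤ.+ x ℤ.* a ℤ.+ y ℤ.* b ℤ.+ z ℤ.* c ℤ.+ m ℤ.* c
  raise₂ = ℤ-Solver.solve-∀

  add-bounds : ∀ k x y z k′ x′ y′ z′ a b c →
    (k ℤ.+ x ℤ.* a ℤ.+ y ℤ.* b ℤ.+ z ℤ.* c) ℤ.+ (k′ ℤ.+ x′ ℤ.* a ℤ.+ y′ ℤ.* b ℤ.+ z′ ℤ.* c) ≡
    (k ℤ.+ k′) ℤ.+ (x ℤ.+ x′) ℤ.* a ℤ.+ (y ℤ.+ y′) ℤ.* b ℤ.+ (z ℤ.+ z′) ℤ.* c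
  add-bounds = ℤ-Solver.solve-∀

  dot-neg : ∀ {n} (w : Vec ℤ n) v → dot (Vec.map ℤ.-_ w) v ≡ ℤ.- dot w v
  dot-neg []      []      = refl
  dot-neg (w ∷ ws) (v ∷ vs) = trans
    (cong₂ ℤ._+_ (sym (ℤ.neg-distribˡ-* w (ℤ.+ v))) (dot-neg ws vs)) (sym (ℤ.neg-distrib-+ (w ℤ.* ℤ.+ v) (dot ws vs)))

  split : ∀ n d i j → (n + d) * i + n * j ≡ n * (i + j) + d * i
  split = solve-∀

  -- The part n * (i + j) is common to both sides; what remains is (1 + d) * i.
  steeper : ∀ n d i j i′ j′ → (n + suc d) * i + n * j ≡ (n + suc d) * i′ + n * j′ → i + j ≡ i′ + j′ → i ≡ i′
  steeper n d i j i′ j′ e s = *-cancelˡ-≡ i i′ (suc d) (+-cancelˡ-≡ (n * (i + j)) _ _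
    (trans (sym (split n (suc d) i j)) (trans e (trans (split n (suc d) i′ j′)
      (cong (λ l → n * l + suc d * i′) (sym s))))))

  slope-injective : ∀ m n i j i′ j′ → m ≢ n → m * i + n * j ≡ m * i′ + n * j′ → i + j ≡ i′ + j′ → i ≡ i′
  slope-injective m n i j i′ j′ m≢n e s with <-cmp m n
  ... | tri≈ _ m≡n _ = ⊥-elim (m≢n m≡n)
  ... | tri> _ _ n<m with (d , refl) ← m≤n⇒∃[o]m+o≡n n<m =
    steeper n d i j i′ j′ (subst (λ l → l * i + n * j ≡ l * i′ + n * j′) (sym (+-suc n d)) e) s
  -- The mirror case: `steeper` recovers j, which is then cancelled from the common sum.
  ... | tri< m<n _ _ with (d , refl) ← m≤n⇒∃[o]m+o≡n m<n = +-cancelʳ-≡ j i i′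
    (trans s (cong (i′ +_) (sym (steeper m d j i j′ i′
      (trans (+-comm _ (m * i)) (trans (subst (λ l → m * i + l * j ≡ m * i′ + l * j′) (sym (+-suc m d)) e) (+-comm (m * i′) _)))
      (trans (+-comm j i) (trans s (+-comm i′ j′)))))))

allPairs-∈ : ∀ {A : Set} (R : A → A → Bool) {xs x y} → allPairs R xs ≡ true → x ∈ xs → y ∈ xs → T (R x y)
allPairs-∈ R {xs} {x} t x∈ y∈ = all-∈ (R x) (all-true (λ x → all (R x) xs) t x∈) y∈

checked-pair : ∀ {n} (ws : List (Vec ℤ n)) f → injectiveCheck ws f ≡ true →
  ∀ r r′ → T (discern (entry ws f r) (entry ws f r′))
checked-pair ws f t r r′ = allPairs-∈ discern {map (entry ws f) regions} {entry ws f r} {entry ws f r′} t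
  (∈-map⁺ (entry ws f) {xs = regions} (∈-regions r)) (∈-map⁺ (entry ws f) {xs = regions} (∈-regions r′))

module Separation (a b c : ℕ) where

  open Nodes a b c
  open Evaluation a b c

  ⟦_⟧ᵇ : Bound → ℤ
  ⟦ bound k x y z ⟧ᵇ = k ℤ.+ x ℤ.* ℤ.+ a ℤ.+ y ℤ.* ℤ.+ b ℤ.+ z ℤ.* ℤ.+ c

  private
    lift : ∀ F i j → ℤ.+ (⟦ F ⟧ i j) ≡ ℤ.+ const F ℤ.+ ℤ.+ ca F ℤ.* ℤ.+ a ℤ.+ ℤ.+ cb F ℤ.* ℤ.+ b ℤ.+
      ℤ.+ cc F ℤ.* ℤ.+ c ℤ.+ ℤ.+ ci F ℤ.* ℤ.+ i ℤ.+ ℤ.+ cj F ℤ.* ℤ.+ j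
    lift (form k x y z m n) i j = cong₂ ℤ._+_ (cong₂ ℤ._+_ (cong₂ ℤ._+_ (cong₂ ℤ._+_ (cong₂ ℤ._+_ (refl {x = ℤ.+ k})
      (ℤ.pos-* x a)) (ℤ.pos-* y b)) (ℤ.pos-* z c)) (ℤ.pos-* m i)) (ℤ.pos-* n j)

    dot-eval : ∀ {n} (w : Vec ℤ n) Fs i j → dot w (values Fs i j) ≡
      dot w (Vec.map const Fs) ℤ.+ dot w (Vec.map ca Fs) ℤ.* ℤ.+ a ℤ.+ dot w (Vec.map cb Fs) ℤ.* ℤ.+ b ℤ.+
      dot w (Vec.map cc Fs) ℤ.* ℤ.+ c ℤ.+ dot w (Vec.map ci Fs) ℤ.* ℤ.+ i ℤ.+ dot w (Vec.map cj Fs) ℤ.* ℤ.+ j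
    dot-eval []       []       i j = refl
    dot-eval (w ∷ ws) (F ∷ Fs) i j = trans
      (cong₂ (λ f g → w ℤ.* f ℤ.+ g) (lift F i j) (dot-eval ws Fs i j))
      (dot-step w (ℤ.+ const F) (ℤ.+ ca F) (ℤ.+ cb F) (ℤ.+ cc F) (ℤ.+ ci F) (ℤ.+ cj F)
        (dot ws (Vec.map const Fs)) (dot ws (Vec.map ca Fs)) (dot ws (Vec.map cb Fs)) (dot ws (Vec.map cc Fs))
        (dot ws (Vec.map ci Fs)) (dot ws (Vec.map cj Fs)) (ℤ.+ a) (ℤ.+ b) (ℤ.+ c) (ℤ.+ i) (ℤ.+ j))

    ⟦raise⟧ : ∀ s m B → ⟦ raise s m B ⟧ᵇ ≡ ⟦ B ⟧ᵇ ℤ.+ m ℤ.* ℤ.+ len s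
    ⟦raise⟧ nothing   m B = sym (trans (cong (λ z → ⟦ B ⟧ᵇ ℤ.+ z) (ℤ.*-zeroʳ m)) (ℤ.+-identityʳ ⟦ B ⟧ᵇ))
    ⟦raise⟧ (just 0F) m (bound k x y z) = raise₀ k x y z m (ℤ.+ a) (ℤ.+ b) (ℤ.+ c)
    ⟦raise⟧ (just 1F) m (bound k x y z) = raise₁ k x y z m (ℤ.+ a) (ℤ.+ b) (ℤ.+ c)
    ⟦raise⟧ (just 2F) m (bound k x y z) = raise₂ k x y z m (ℤ.+ a) (ℤ.+ b) (ℤ.+ c)

    convex : ∀ m n i j → m ℤ.* ℤ.+ i ℤ.+ n ℤ.* ℤ.+ j ℤ.≤ (m ℤ.⊔ n) ℤ.* ℤ.+ (i + j)
    convex m n i j = ℤ.≤-trans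
      (ℤ.+-mono-≤ (ℤ.*-monoʳ-≤-nonNeg (ℤ.+ i) (ℤ.i≤i⊔j m n)) (ℤ.*-monoʳ-≤-nonNeg (ℤ.+ j) (ℤ.i≤j⊔i m n)))
      (ℤ.≤-reflexive (sym (ℤ.*-distribˡ-+ (m ℤ.⊔ n) (ℤ.+ i) (ℤ.+ j))))

  upper-sound : ∀ {n} s (w : Vec ℤ n) Fs i j → i + j ≡ len s → dot w (values Fs i j) ℤ.≤ ⟦ upper s w Fs ⟧ᵇ
  upper-sound s w Fs i j e = begin
    dot w (values Fs i j)                        ≡⟨ dot-eval w Fs i j ⟩
    base ℤ.+ m ℤ.* ℤ.+ i ℤ.+ n ℤ.* ℤ.+ j         ≡⟨ ℤ.+-assoc base (m ℤ.* ℤ.+ i) (n ℤ.* ℤ.+ j) ⟩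
    base ℤ.+ (m ℤ.* ℤ.+ i ℤ.+ n ℤ.* ℤ.+ j)       ≤⟨ ℤ.+-monoʳ-≤ base (convex m n i j) ⟩
    base ℤ.+ (m ℤ.⊔ n) ℤ.* ℤ.+ (i + j)           ≡⟨ cong (λ l → base ℤ.+ (m ℤ.⊔ n) ℤ.* ℤ.+ l) e ⟩
    base ℤ.+ (m ℤ.⊔ n) ℤ.* ℤ.+ len s             ≡⟨ sym (⟦raise⟧ s (m ℤ.⊔ n) B) ⟩
    ⟦ upper s w Fs ⟧ᵇ                            ∎
    where
    open ℤ.≤-Reasoning
    m n : ℤ
    m = dot w (Vec.map ci Fs)
    n = dot w (Vec.map cj Fs)
    B : Bound
    B = bound (dot w (Vec.map const Fs)) (dot w (Vec.map ca Fs)) (dot w (Vec.map cb Fs)) (dot w (Vec.map cc Fs))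
    base : ℤ
    base = ⟦ B ⟧ᵇ

  private
    shrink : ∀ x n → T (x ℤ.≤ᵇ 0ℤ) → x ℤ.* ℤ.+ n ℤ.≤ 0ℤ
    shrink x n t = ℤ.*-monoʳ-≤-nonNeg (ℤ.+ n) (ℤ.≤ᵇ⇒≤ {x} {0ℤ} t)

  negative-sound : ∀ B B′ → T (negative B B′) → ⟦ B ⟧ᵇ ℤ.+ ⟦ B′ ⟧ᵇ ℤ.≤ -1ℤ
  negative-sound (bound k x y z) (bound k′ x′ y′ z′) t
    with (k≤ , t) ← to (T-∧ {k ℤ.+ k′ ℤ.≤ᵇ -1ℤ}) t
    with (x≤ , t) ← to (T-∧ {x ℤ.+ x′ ℤ.≤ᵇ 0ℤ}) t
    with (y≤ , z≤) ← to (T-∧ {y ℤ.+ y′ ℤ.≤ᵇ 0ℤ}) t =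
    ℤ.≤-trans (ℤ.≤-reflexive (add-bounds k x y z k′ x′ y′ z′ (ℤ.+ a) (ℤ.+ b) (ℤ.+ c)))
      (ℤ.+-mono-≤ (ℤ.+-mono-≤ (ℤ.+-mono-≤ (ℤ.≤ᵇ⇒≤ {k ℤ.+ k′} { -1ℤ} k≤) (shrink (x ℤ.+ x′) a x≤)) (shrink (y ℤ.+ y′) b y≤))
        (shrink (z ℤ.+ z′) c z≤))

  private
    clash : ∀ {g B B′} → g ℤ.≤ ⟦ B ⟧ᵇ → ℤ.- g ℤ.≤ ⟦ B′ ⟧ᵇ → T (negative B B′) → ⊥
    clash {g} {B} {B′} u v t = impossible (ℤ.≤-trans (ℤ.≤-trans (ℤ.≤-reflexive (sym (ℤ.+-inverseʳ g))) (ℤ.+-mono-≤ u v))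
      (negative-sound B B′ t))
      where
      impossible : 0ℤ ℤ.≤ -1ℤ → ⊥
      impossible ()

    clash′ : ∀ {g B B′} → ℤ.- g ℤ.≤ ⟦ B ⟧ᵇ → g ℤ.≤ ⟦ B′ ⟧ᵇ → T (negative B B′) → ⊥
    clash′ {g} {B} {B′} u v t = clash {ℤ.- g} {B} {B′} u (ℤ.≤-trans (ℤ.≤-reflexive (ℤ.neg-involutive g)) v) t

  -- At a common value v the numbers w·v and -w·v are bounded by the two recorded maxima, so 0 would
  -- be at most their sum, which is at most -1.
  apart-sound : ∀ {n} (ws : List (Vec ℤ n)) s s′ Fs Fs′ i j i′ j′ → i + j ≡ len s → i′ + j′ ≡ len s′ →
    values Fs i j ≡ values Fs′ i′ j′ → T (apart (profile ws s Fs) (profile ws s′ Fs′)) → ⊥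
  apart-sound (w ∷ ws) s s′ Fs Fs′ i j i′ j′ e e′ v t
    with to (T-∨ {negative (upper s w Fs) (upper s′ (Vec.map ℤ.-_ w) Fs′)}) t
  ... | inj₁ t = clash {dot w (values Fs i j)} {upper s w Fs} {upper s′ (Vec.map ℤ.-_ w) Fs′}
    (upper-sound s w Fs i j e)
    (ℤ.≤-trans (ℤ.≤-reflexive (trans (cong (ℤ.-_ ∘ dot w) v) (sym (dot-neg w (values Fs′ i′ j′)))))
      (upper-sound s′ (Vec.map ℤ.-_ w) Fs′ i′ j′ e′)) t
  ... | inj₂ t with to (T-∨ {negative (upper s (Vec.map ℤ.-_ w) Fs) (upper s′ w Fs′)}) t
  ... | inj₁ t = clash′ {dot w (values Fs i j)} {upper s (Vec.map ℤ.-_ w) Fs} {upper s′ w Fs′}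
    (ℤ.≤-trans (ℤ.≤-reflexive (sym (dot-neg w (values Fs i j)))) (upper-sound s (Vec.map ℤ.-_ w) Fs i j e))
    (ℤ.≤-trans (ℤ.≤-reflexive (cong (dot w) v)) (upper-sound s′ w Fs′ i′ j′ e′)) t
  ... | inj₂ t = apart-sound ws s s′ Fs Fs′ i j i′ j′ e e′ v t

  private
    sloped-sound : ∀ {n} (Fs : Vec Form n) i j i′ j′ → T (sloped Fs) → values Fs i j ≡ values Fs i′ j′ →
      i + j ≡ i′ + j′ → i ≡ i′
    sloped-sound (F@(form k x y z m n) ∷ Fs) i j i′ j′ t v s with to (T-∨ {not (m ≡ᵇ n)}) t
    ... | inj₂ t = sloped-sound Fs i j i′ j′ t (cong Vec.tail v) s
    ... | inj₁ m≢n = slope-injective m n i j i′ j′ (λ e → T-not m≢n (≡⇒≡ᵇ m n e))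
      (+-cancelˡ-≡ (k + x * a + y * b + z * c) _ _
        (trans (sym (+-assoc _ (m * i) (n * j))) (trans (cong Vec.head v) (+-assoc _ (m * i′) (n * j′))))) s
      where
      T-not : ∀ {b} → T (not b) → T b → ⊥
      T-not {false} _ ()
      T-not {true}  ()

  Code : Set
  Code = Region × ℕ × ℕ

  -- On a region of a single vertex this forces i = j = 0.
  Valid : Code → Set
  Valid (r , i , j) = i + j ≡ len (extent r)

  private
    branch : ∀ {A P : Set} {x y : Bool} (d : Dec P) → T (if does d then x else y) →
      (P → T x → A) → (T y → A) → A
    branch (yes p) t f g = f p t
    branch (no _)  t f g = g t

    same : ∀ {n} (f : Region → Vec Form n) r i j i′ j′ → Valid (r , i , j) → Valid (r , i′ , j′) →
      values (f r) i j ≡ values (f r) i′ j′ → T (is-nothing (extent r) ∨ sloped (f r)) →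
      (r , i , j) ≡ (r , i′ , j′)
    same f r i j i′ j′ e e′ v t =
      cong (r ,_) (cong₂ _,_ i≡i′ (+-cancelˡ-≡ i j j′ (trans sum (cong (_+ j′) (sym i≡i′)))))
      where
      sum : i + j ≡ i′ + j′
      sum = trans e (sym e′)
      short : ∀ s → i + j ≡ len s → i′ + j′ ≡ len s → T (is-nothing s) → i ≡ i′
      short nothing e e′ _ = trans (m+n≡0⇒m≡0 i e) (sym (m+n≡0⇒m≡0 i′ e′))
      i≡i′ : i ≡ i′
      i≡i′ = [ short (extent r) e e′ , (λ t → sloped-sound (f r) i j i′ j′ t v sum) ]′
        (to (T-∨ {is-nothing (extent r)}) t)

  injective : ∀ {n} (ws : List (Vec ℤ n)) (f : Region → Vec Form n) → injectiveCheck ws f ≡ true →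
    ∀ r i j r′ i′ j′ → Valid (r , i , j) → Valid (r′ , i′ , j′) →
    values (f r) i j ≡ values (f r′) i′ j′ → (r , i , j) ≡ (r′ , i′ , j′)
  injective ws f t r i j r′ i′ j′ e e′ v =
    branch (r ≟ʳ r′) (checked-pair ws f t r r′)
      (λ { refl → same f r i j i′ j′ e e′ v })
      (λ u → ⊥-elim (apart-sound ws (extent r) (extent r′) (f r) (f r′) i j i′ j′ e e′ v u))

private
  offset₁ : ∀ k x l → k + 0 + 0 + (x + 0) + 0 + 0 + l ≡ k + (x + l)
  offset₁ = solve-∀
  offset₂ : ∀ k x l → k + 0 + (x + 0) + 0 + 0 + 0 + l ≡ k + (x + l)
  offset₂ = solve-∀
  offset₃ : ∀ k x l → k + (x + 0) + 0 + 0 + 0 + 0 + l ≡ k + (x + l)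
  offset₃ = solve-∀
  offset₄ : ∀ k b → k + 0 + (b + 0) + 0 + 0 + 0 ≡ k + b
  offset₄ = solve-∀
  offset₅ : ∀ k c → k + 0 + 0 + (c + 0) + 0 + 0 ≡ k + c
  offset₅ = solve-∀
  ac : ∀ a c → 6 + (a + 0) + 0 + (c + 0) + 0 + 0 ≡ 2 + (a + (4 + c))
  ac = solve-∀
  bc : ∀ b c → 6 + 0 + (b + 0) + (c + 0) + 0 + 0 ≡ 2 + (b + (4 + c))
  bc = solve-∀
  step-i : ∀ k i → k + 0 + 0 + 0 + (i + 0) + 0 ≡ k + i
  step-i = solve-∀
  step-j : ∀ k j → k + 0 + 0 + 0 + 0 + (j + 0) ≡ k + j
  step-j = solve-∀
  bump : ∀ k i l j → (k + i) + (l + j) ≡ k + l + (i + j)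
  bump = solve-∀

-- Vertices and edges

-- The hexagon meant is centred at (q + 1 , r + 1), which keeps the six surrounding triangles inside
-- ℕ. The tags alternate round the hexagon.
cornerAt : Fin 6 → ℕ × ℕ → LVertex
cornerAt 0F (q , r) = q     , suc r , true
cornerAt 1F (q , r) = q     , r     , false
cornerAt 2F (q , r) = suc q , r     , true
cornerAt 3F (q , r) = suc q , r     , false
cornerAt 4F (q , r) = suc q , suc r , true
cornerAt 5F (q , r) = q     , suc r , false

coords : LVertex → Vec ℕ 3
coords (x , y , t) = x ∷ y ∷ (if t then 1 else 0) ∷ []

coords-injective : ∀ u v → coords u ≡ coords v → u ≡ v
coords-injective (x , y , true)  (.x , .y , true)  refl = refl
coords-injective (x , y , false) (.x , .y , false) refl = refl

module Geometry (a b c : ℕ) where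

  open Nodes a b c public
  open Evaluation a b c public
  open Separation a b c public

  hexAt : Sector → Piece → ℕ → ℕ → ℕ × ℕ
  hexAt k π i j = ⟦ proj₁ (hexᶠ k π) ⟧ i j , ⟦ proj₂ (hexᶠ k π) ⟧ i j

  private
    ⟦scale⟧ : ∀ p i j → ⟦ scale p 1 ⟧ i j ≡ par p
    ⟦scale⟧ p i j = trans (⟦spanForm⟧ (just p) 1 i j) (*-identityˡ (par p))

    ⟦num⊞⟧ : ∀ k F i j → ⟦ num k ⊞ F ⟧ i j ≡ k + ⟦ F ⟧ i j
    ⟦num⊞⟧ k F i j = trans (⟦⊞⟧ (num k) F i j) (cong (_+ ⟦ F ⟧ i j) (⟦num⟧ k i j))

    nodeᶠ-sound : ∀ k ch J J* i j →
      (⟦ proj₁ (nodeᶠ k ch J J*) ⟧ i j , ⟦ proj₂ (nodeᶠ k ch J J*) ⟧ i j) ≡ node k ch (⟦ J ⟧ i j) (⟦ J* ⟧ i j)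
    nodeᶠ-sound 0F armᶜ J J* i j = cong₂ _,_
      (trans (⟦⊞⟧ (form 3 0 0 1 0 0) J i j) (offset₁ 3 c (⟦ J ⟧ i j))) (offset₄ 3 b)
    nodeᶠ-sound 0F leftᶜ J J* i j = cong₂ _,_ (ac a c) refl
    nodeᶠ-sound 0F rightᶜ J J* i j = cong₂ _,_
      (trans (⟦⊞⟧ (form 3 1 0 0 0 0) J* i j) (offset₃ 3 a (⟦ J* ⟧ i j)))
      (trans (⟦⊞⟧ (form 3 0 1 0 0 0) J i j) (offset₂ 3 b (⟦ J ⟧ i j)))
    nodeᶠ-sound 1F armᶜ J J* i j = cong₂ _,_ (offset₅ 3 c) (⟦num⊞⟧ 1 J* i j)
    nodeᶠ-sound 1F leftᶜ J J* i j = refl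
    nodeᶠ-sound 1F rightᶜ J J* i j = cong₂ _,_
      (trans (⟦⊞⟧ (form 3 0 0 1 0 0) J i j) (offset₁ 3 c (⟦ J ⟧ i j))) refl
    nodeᶠ-sound 2F armᶜ J J* i j = cong₂ _,_ (⟦num⊞⟧ 1 J* i j)
      (trans (⟦⊞⟧ (form 3 0 1 0 0 0) J i j) (offset₂ 3 b (⟦ J ⟧ i j)))
    nodeᶠ-sound 2F leftᶜ J J* i j = cong₂ _,_ refl (bc b c)
    nodeᶠ-sound 2F rightᶜ J J* i j = cong₂ _,_ refl
      (trans (⟦⊞⟧ (form 3 0 0 1 0 0) J* i j) (offset₁ 3 c (⟦ J* ⟧ i j)))

    unit : Sector → Piece → Form
    unit k π = scale (axis k (chain π)) 1

    along : Sector → Piece → ℕ → ℕ → ℕ × ℕ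
    along k hub     i j = 0 , 2 + par (axis k armᶜ)
    along k arm     i j = 1 + i , 1 + j
    along k tip     i j = 2 + par (axis k armᶜ) , 0
    along k cornerˡ i j = 0 , 3 + par (axis k leftᶜ)
    along k kneeˡ   i j = 1 , 2 + par (axis k leftᶜ)
    along k sideˡ   i j = 2 + i , 1 + j
    along k endˡ    i j = 3 + par (axis k leftᶜ) , 0
    along k cornerʳ i j = 0 , 3 + par (axis k rightᶜ)
    along k kneeʳ   i j = 1 , 2 + par (axis k rightᶜ)
    along k sideʳ   i j = 2 + i , 1 + j
    along k endʳ    i j = 3 + par (axis k rightᶜ) , 0

    ⟦num⊞unit⟧ : ∀ n p i j → ⟦ num n ⊞ scale p 1 ⟧ i j ≡ n + par p
    ⟦num⊞unit⟧ n p i j = trans (⟦num⊞⟧ n (scale p 1) i j) (cong (n +_) (⟦scale⟧ p i j))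

    place-sound : ∀ k π i j → (⟦ proj₁ (place π (unit k π)) ⟧ i j , ⟦ proj₂ (place π (unit k π)) ⟧ i j) ≡ along k π i j
    place-sound k hub     i j = cong₂ _,_ refl (⟦num⊞unit⟧ 2 (axis k armᶜ) i j)
    place-sound k arm     i j = cong₂ _,_ (step-i 1 i) (step-j 1 j)
    place-sound k tip     i j = cong₂ _,_ (⟦num⊞unit⟧ 2 (axis k armᶜ) i j) refl
    place-sound k cornerˡ i j = cong₂ _,_ refl (⟦num⊞unit⟧ 3 (axis k leftᶜ) i j)
    place-sound k kneeˡ   i j = cong₂ _,_ refl (⟦num⊞unit⟧ 2 (axis k leftᶜ) i j)
    place-sound k sideˡ   i j = cong₂ _,_ (step-i 2 i) (step-j 1 j)
    place-sound k endˡ    i j = cong₂ _,_ (⟦num⊞unit⟧ 3 (axis k leftᶜ) i j) refl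
    place-sound k cornerʳ i j = cong₂ _,_ refl (⟦num⊞unit⟧ 3 (axis k rightᶜ) i j)
    place-sound k kneeʳ   i j = cong₂ _,_ refl (⟦num⊞unit⟧ 2 (axis k rightᶜ) i j)
    place-sound k sideʳ   i j = cong₂ _,_ (step-i 2 i) (step-j 1 j)
    place-sound k endʳ    i j = cong₂ _,_ (⟦num⊞unit⟧ 3 (axis k rightᶜ) i j) refl

    along-sum : ∀ k π i j → i + j ≡ len (span k π) →
      proj₁ (along k π i j) + proj₂ (along k π i j) ≡ size k (chain π)
    along-sum k hub     i j e = refl
    along-sum k arm     i j e = trans (bump 1 i 1 j) (cong (2 +_) e)
    along-sum k tip     i j e = +-identityʳ _
    along-sum k cornerˡ i j e = refl
    along-sum k kneeˡ   i j e = refl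
    along-sum k sideˡ   i j e = trans (bump 2 i 1 j) (cong (3 +_) e)
    along-sum k endˡ    i j e = +-identityʳ _
    along-sum k cornerʳ i j e = refl
    along-sum k kneeʳ   i j e = refl
    along-sum k sideʳ   i j e = trans (bump 2 i 1 j) (cong (3 +_) e)
    along-sum k endʳ    i j e = +-identityʳ _

    hexAt-along : ∀ k π i j → hexAt k π i j ≡ node k (chain π) (proj₁ (along k π i j)) (proj₂ (along k π i j))
    hexAt-along k π i j = trans
      (nodeᶠ-sound k (chain π) (proj₁ (place π (unit k π))) (proj₂ (place π (unit k π))) i j)
      (cong (λ (J , J*) → node k (chain π) J J*) (place-sound k π i j))

  hexAt-present : ∀ k π i j → i + j ≡ len (span k π) → Hexagon (proj₁ (hexAt k π i j)) (proj₂ (hexAt k π i j))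
  hexAt-present k π i j e = subst (λ h → Hexagon (proj₁ h) (proj₂ h)) (sym (hexAt-along k π i j))
    (node-present k (chain π) (proj₁ (along k π i j)) (proj₂ (along k π i j)) (along-sum k π i j e))

  HexCode : ℕ → ℕ → Set
  HexCode q r = ∃[ k ] ∃[ π ] ∃[ i ] ∃[ j ] (i + j ≡ len (span k π) × (q , r) ≡ hexAt k π i j)

  private
    peel : ∀ n i j {s} → suc n + i + suc j ≡ suc (suc n + s) → i + j ≡ s
    peel n i j {s} e = +-cancelˡ-≡ n (i + j) s
      (suc-injective (suc-injective (trans (sym (trans (+-suc (suc n + i) j) (cong (λ z → suc (suc z)) (+-assoc n i j)))) e)))

    piece : ∀ k ch J J* → J + J* ≡ size k ch →
      ∃[ π ] ∃[ i ] ∃[ j ] (i + j ≡ len (span k π) × node k ch J J* ≡ hexAt k π i j)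
    piece k armᶜ zero J* refl = hub , 0 , 0 , refl , sym (hexAt-along k hub 0 0)
    piece k armᶜ (suc J) zero e = tip , 0 , 0 , refl ,
      trans (cong (λ z → node k armᶜ z 0) (trans (sym (+-identityʳ (suc J))) e)) (sym (hexAt-along k tip 0 0))
    piece k armᶜ (suc J) (suc J*) e = arm , J , J* , peel 0 J J* e , sym (hexAt-along k arm J J*)
    piece k leftᶜ zero J* refl = cornerˡ , 0 , 0 , refl , sym (hexAt-along k cornerˡ 0 0)
    piece k leftᶜ (suc zero) J* e = kneeˡ , 0 , 0 , refl ,
      trans (cong (node k leftᶜ 1) (suc-injective e)) (sym (hexAt-along k kneeˡ 0 0))
    piece k leftᶜ (suc (suc J)) zero e = endˡ , 0 , 0 , refl ,
      trans (cong (λ z → node k leftᶜ z 0) (trans (sym (+-identityʳ (2 + J))) e)) (sym (hexAt-along k endˡ 0 0))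
    piece k leftᶜ (suc (suc J)) (suc J*) e = sideˡ , J , J* , peel 1 J J* e , sym (hexAt-along k sideˡ J J*)
    piece k rightᶜ zero J* refl = cornerʳ , 0 , 0 , refl , sym (hexAt-along k cornerʳ 0 0)
    piece k rightᶜ (suc zero) J* e = kneeʳ , 0 , 0 , refl ,
      trans (cong (node k rightᶜ 1) (suc-injective e)) (sym (hexAt-along k kneeʳ 0 0))
    piece k rightᶜ (suc (suc J)) zero e = endʳ , 0 , 0 , refl ,
      trans (cong (λ z → node k rightᶜ z 0) (trans (sym (+-identityʳ (2 + J))) e)) (sym (hexAt-along k endʳ 0 0))
    piece k rightᶜ (suc (suc J)) (suc J*) e = sideʳ , J , J* , peel 1 J J* e , sym (hexAt-along k sideʳ J J*)

  hexCode : ∀ q r → Hexagon q r → HexCode q r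
  hexCode q r t with (k , ch , J , J* , e , q≡) ← located q r t
                with (π , i , j , e′ , h≡) ← piece k ch J J* e = k , π , i , j , e′ , trans q≡ h≡

  A B C : ℕ
  A = 4 + a
  B = 4 + b
  C = 4 + c

  private
    H : ℕ → ℕ → Bool
    H = fcsHex A B C

    ∨ˡ : ∀ {x y} → T x → T (x ∨ y)
    ∨ˡ t = from T-∨ (inj₁ t)
    ∨ʳ : ∀ x {y} → T y → T (x ∨ y)
    ∨ʳ x t = from (T-∨ {x}) (inj₂ t)
    refl∧ : ∀ x {p} → T p → T ((x ≡ᵇ x) ∧ p)
    refl∧ x t = from T-∧ (≡⇒≡ᵇ x x refl , t)

  corner-vertex : ∀ t q r → Hexagon q r → T (isVertex A B C (cornerAt t (q , r)))
  corner-vertex 0F q r h = ∨ʳ (H q (suc r)) (∨ˡ h)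
  corner-vertex 1F q r h = ∨ʳ (H (suc q) r) (∨ʳ (H q (suc r)) h)
  corner-vertex 2F q r h = ∨ʳ (H (suc q) r) (∨ʳ (H (suc (suc q)) r) h)
  corner-vertex 3F q r h = ∨ʳ (H (suc (suc q)) r) (∨ˡ h)
  corner-vertex 4F q r h = ∨ˡ {H (suc q) (suc r)} h
  corner-vertex 5F q r h = ∨ˡ {H (suc q) (suc r)} h

  private
    level : ∀ x y → T (H (suc x) y ∨ H x (suc y)) → T (upDownEdge A B C x y x y)
    level x y h = ∨ˡ (refl∧ x (refl∧ y h))

    leftward : ∀ x y → T (H (suc x) y ∨ H (suc x) (suc y)) → T (upDownEdge A B C (suc x) y x y)
    leftward x y h = ∨ʳ ((x ≡ᵇ suc x) ∧ (y ≡ᵇ y) ∧ (H (suc (suc x)) y ∨ H (suc x) (suc y)))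
      (∨ˡ (refl∧ x (refl∧ y h)))

    downward : ∀ x y → T (H x (suc y) ∨ H (suc x) (suc y)) → T (upDownEdge A B C x (suc y) x y)
    downward x y h = ∨ʳ ((x ≡ᵇ x) ∧ (y ≡ᵇ suc y) ∧ (H (suc x) (suc y) ∨ H x (suc (suc y))))
      (∨ʳ ((suc x ≡ᵇ x) ∧ (y ≡ᵇ suc y) ∧ (H x (suc y) ∨ H x (suc (suc y)))) (refl∧ x (refl∧ y h)))

  corner-edge : ∀ t q r → Hexagon q r → T (isEdge A B C (cornerAt t (q , r)) (cornerAt (next t) (q , r)))
  corner-edge 0F q r h = downward q r (∨ʳ (H q (suc r)) h)
  corner-edge 1F q r h = leftward q r (∨ʳ (H (suc q) r) h)
  corner-edge 2F q r h = level (suc q) r (∨ʳ (H (suc (suc q)) r) h)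
  corner-edge 3F q r h = downward (suc q) r (∨ˡ {H (suc q) (suc r)} h)
  corner-edge 4F q r h = leftward q (suc r) (∨ˡ {H (suc q) (suc r)} h)
  corner-edge 5F q r h = level q (suc r) (∨ˡ {H (suc q) (suc r)} h)

  edge-sym : ∀ u v → T (isEdge A B C u v) → T (isEdge A B C v u)
  edge-sym (x , y , true)  (x′ , y′ , false) t = t
  edge-sym (x , y , false) (x′ , y′ , true)  t = t

  OnCorner : LVertex → Set
  OnCorner v = ∃[ q ] ∃[ r ] ∃[ t ] (Hexagon q r × v ≡ cornerAt t (q , r))

  -- No hexagon has a zero coordinate in `fcsHex`, so the clauses may assume successors where a
  -- hexagon is present.
  vertex-corner : ∀ v → T (isVertex A B C v) → OnCorner v
  vertex-corner (x , y , true) t with to (T-∨ {H x y}) t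
  vertex-corner (suc q , suc r , true) t | inj₁ h = q , r , 4F , h , refl
  ... | inj₂ t with to (T-∨ {H (suc x) y}) t
  vertex-corner (x , suc r , true) _ | inj₂ _ | inj₁ h = x , r , 0F , h , refl
  vertex-corner (suc q , y , true) _ | inj₂ _ | inj₂ h = q , y , 2F , h , refl
  vertex-corner (x , y , false) t with to (T-∨ {H (suc x) y}) t
  vertex-corner (x , suc r , false) t | inj₁ h = x , r , 5F , h , refl
  ... | inj₂ t with to (T-∨ {H x (suc y)}) t
  vertex-corner (suc q , y , false) _ | inj₂ _ | inj₁ h = q , y , 3F , h , refl
  vertex-corner (x , y , false) _ | inj₂ _ | inj₂ h = x , y , 1F , h , refl

  OnSide : LVertex → LVertex → Set
  OnSide u v = ∃[ q ] ∃[ r ] ∃[ t ] (Hexagon q r × u ≡ cornerAt t (q , r) × v ≡ cornerAt (next t) (q , r))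

  private
    -- The two hexagons at an edge run through it in opposite directions; which of them is present
    -- decides the orientation. The same holds for the other two edge directions below.
    level-side : ∀ x y → T (H (suc x) y ∨ H x (suc y)) →
      OnSide (x , y , true) (x , y , false) ⊎ OnSide (x , y , false) (x , y , true)
    level-side x y t with to (T-∨ {H (suc x) y}) t
    level-side x (suc r) t | inj₁ h = inj₂ (x , r , 5F , h , refl , refl)
    level-side (suc q) y t | inj₂ h = inj₁ (q , y , 2F , h , refl , refl)

    leftward-side : ∀ x y → T (H (suc x) y ∨ H (suc x) (suc y)) →
      OnSide (suc x , y , true) (x , y , false) ⊎ OnSide (x , y , false) (suc x , y , true)
    leftward-side x y t with to (T-∨ {H (suc x) y}) t
    leftward-side x (suc r) t | inj₁ h = inj₁ (x , r , 4F , h , refl , refl)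
    leftward-side x y t       | inj₂ h = inj₂ (x , y , 1F , h , refl , refl)

    downward-side : ∀ x y → T (H x (suc y) ∨ H (suc x) (suc y)) →
      OnSide (x , suc y , true) (x , y , false) ⊎ OnSide (x , y , false) (x , suc y , true)
    downward-side x y t with to (T-∨ {H x (suc y)}) t
    downward-side (suc q) y t | inj₁ h = inj₂ (q , y , 3F , h , refl , refl)
    downward-side x y t       | inj₂ h = inj₁ (x , y , 0F , h , refl , refl)

    match : ∀ x x′ y y′ {p} → T ((x ≡ᵇ x′) ∧ (y ≡ᵇ y′) ∧ p) → x ≡ x′ × y ≡ y′ × T p
    match x x′ y y′ t with (ex , t) ← to (T-∧ {x ≡ᵇ x′}) t
                      with (ey , t) ← to (T-∧ {y ≡ᵇ y′}) t = ≡ᵇ⇒≡ x x′ ex , ≡ᵇ⇒≡ y y′ ey , t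

    upDown-side : ∀ x y x′ y′ → T (upDownEdge A B C x y x′ y′) →
      OnSide (x , y , true) (x′ , y′ , false) ⊎ OnSide (x′ , y′ , false) (x , y , true)
    upDown-side x y x′ y′ t
      with to (T-∨ {(x′ ≡ᵇ x) ∧ (y′ ≡ᵇ y) ∧ (H (suc x) y ∨ H x (suc y))}) t
    ... | inj₁ t with (refl , refl , t) ← match x′ x y′ y t = level-side x y t
    ... | inj₂ t with to (T-∨ {(suc x′ ≡ᵇ x) ∧ (y′ ≡ᵇ y) ∧ (H x y ∨ H x (suc y))}) t
    ... | inj₁ t with (refl , refl , t) ← match (suc x′) x y′ y t = leftward-side x′ y t
    ... | inj₂ t with (refl , refl , t) ← match x′ x (suc y′) y t = downward-side x y′ t

  edge-side : ∀ u v → T (isEdge A B C u v) → OnSide u v ⊎ OnSide v u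
  edge-side (x , y , true)  (x′ , y′ , false) t = upDown-side x y x′ y′ t
  edge-side (x , y , false) (x′ , y′ , true)  t = [ inj₂ , inj₁ ]′ (upDown-side x′ y′ x y t)

∈-pieces : ∀ π → π ∈ pieces
∈-pieces hub     = here refl
∈-pieces arm     = there (here refl)
∈-pieces tip     = there (there (here refl))
∈-pieces cornerˡ = there (there (there (here refl)))
∈-pieces kneeˡ   = there (there (there (there (here refl))))
∈-pieces sideˡ   = there (there (there (there (there (here refl)))))
∈-pieces endˡ    = there (there (there (there (there (there (here refl))))))
∈-pieces cornerʳ = there (there (there (there (there (there (there (here refl)))))))
∈-pieces kneeʳ   = there (there (there (there (there (there (there (there (here refl))))))))
∈-pieces sideʳ   = there (there (there (there (there (there (there (there (there (here refl)))))))))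
∈-pieces endʳ    = there (there (there (there (there (there (there (there (there (there (here refl))))))))))

T-not-elim : ∀ {x} → T (not x) → T x → ⊥
T-not-elim {false} _ ()

allCharts-sound : ∀ p → allCharts p ≡ true → ∀ k π later → (T later → T (long π)) → T (p (k , π , later))
allCharts-sound p t k π = go (to T-∧ (all-∈ (λ π → p (k , π , false) ∧ (not (long π) ∨ p (k , π , true))) {pieces}
    (all-true (λ k → all (λ π → p (k , π , false) ∧ (not (long π) ∨ p (k , π , true))) pieces) {allFin 3} t (∈-allFin k))
    (∈-pieces π)))
  where
  go : T (p (k , π , false)) × T (not (long π) ∨ p (k , π , true)) → ∀ later → (T later → T (long π)) → T (p (k , π , later))
  go (t , _) false l = t
  go (_ , t) true  l = [ (λ n → ⊥-elim (T-not-elim n (l tt))) , (λ t → t) ]′ (to (T-∨ {not (long π)}) t)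

cyclic-sound : ∀ {A : Set} (R : A → A → Bool) (g : Fin 6 → A) → T (cyclic R g) → ∀ t → T (R (g t) (g (next t)))
cyclic-sound R g t u
  with (t₀ , t) ← to (T-∧ {R (g 0F) (g 1F)}) t
  with (t₁ , t) ← to (T-∧ {R (g 1F) (g 2F)}) t
  with (t₂ , t) ← to (T-∧ {R (g 2F) (g 3F)}) t
  with (t₃ , t) ← to (T-∧ {R (g 3F) (g 4F)}) t
  with (t₄ , t₅) ← to (T-∧ {R (g 4F) (g 5F)}) t = go u
  where
  go : ∀ u → T (R (g u) (g (next u)))
  go 0F = t₀
  go 1F = t₁
  go 2F = t₂
  go 3F = t₃
  go 4F = t₄
  go 5F = t₅

spin-next : ∀ k t → spin k (next t) ≡ next (spin k t)
spin-next 0F t = refl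
spin-next 1F t = refl
spin-next 2F t = refl

next⁶ : ∀ t → next (next (next (next (next (next t))))) ≡ t
next⁶ 0F = refl
next⁶ 1F = refl
next⁶ 2F = refl
next⁶ 3F = refl
next⁶ 4F = refl
next⁶ 5F = refl

spin-opposite : ∀ k t → spin k (spin (opposite k) t) ≡ t
spin-opposite 0F t = refl
spin-opposite 1F t = next⁶ t
spin-opposite 2F t = next⁶ t

==ˢ-sound : ∀ s s′ → T (s ==ˢ s′) → s ≡ s′
==ˢ-sound nothing  nothing   _ = refl
==ˢ-sound (just p) (just p′) t with p Fin.≟ p′
... | yes refl = refl

-- From charts to actual vertices

module Atlas (a b c : ℕ) where

  open Geometry a b c public

  posAt : Code → LVertex
  posAt (r , i , j) = cornerAt (spin (proj₁ r) (homeCorner r)) (hexAt (proj₁ r) (homePiece r) i j)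

  private
    cornerᶠ-values : ∀ t F G i j → values (cornerᶠ t (F , G)) i j ≡ coords (cornerAt t (⟦ F ⟧ i j , ⟦ G ⟧ i j))
    cornerᶠ-values t F G i j = go t
      where
      1+ : ∀ F → ⟦ num 1 ⊞ F ⟧ i j ≡ suc (⟦ F ⟧ i j)
      1+ F = trans (⟦⊞⟧ (num 1) F i j) (cong (_+ ⟦ F ⟧ i j) (⟦num⟧ 1 i j))
      go : ∀ t → values (cornerᶠ t (F , G)) i j ≡ coords (cornerAt t (⟦ F ⟧ i j , ⟦ G ⟧ i j))
      go 0F = cong₂ (λ x y → x ∷ y ∷ 1 ∷ []) refl (1+ G)
      go 1F = refl
      go 2F = cong₂ (λ x y → x ∷ y ∷ 1 ∷ []) (1+ F) refl
      go 3F = cong₂ (λ x y → x ∷ y ∷ 0 ∷ []) (1+ F) refl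
      go 4F = cong₂ (λ x y → x ∷ y ∷ 1 ∷ []) (1+ F) (1+ G)
      go 5F = cong₂ (λ x y → x ∷ y ∷ 0 ∷ []) refl (1+ G)

    inst-values : ∀ {n} m s (Fs : Vec Form n) i j → Ready m s i j →
      values (Vec.map (inst m s) Fs) i j ≡ values Fs (iAt m s i j) (jAt m s i j)
    inst-values m s []       i j ok = refl
    inst-values m s (F ∷ Fs) i j ok = cong₂ _∷_ (inst-sound m s F i j ok) (inst-values m s Fs i j ok)

    all≡ᶠ-sound : ∀ {n} (Fs Gs : Vec Form n) i j → T (all≡ᶠ Fs Gs) → values Fs i j ≡ values Gs i j
    all≡ᶠ-sound []       []       i j t = refl
    all≡ᶠ-sound (F ∷ Fs) (G ∷ Gs) i j t with (e , t) ← to (T-∧ {F ≡ᶠ G}) t =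
      cong₂ _∷_ (≡ᶠ-sound F G i j e) (all≡ᶠ-sound Fs Gs i j t)

  pos-values : ∀ r i j → values (posᶠ r) i j ≡ coords (posAt (r , i , j))
  pos-values r i j = cornerᶠ-values (spin (proj₁ r) (homeCorner r))
    (proj₁ (hexᶠ (proj₁ r) (homePiece r))) (proj₂ (hexᶠ (proj₁ r) (homePiece r))) i j

  pos-injective : ∀ u v → Valid u → Valid v → posAt u ≡ posAt v → u ≡ v
  pos-injective (r , i , j) (r′ , i′ , j′) e e′ p = injective posFunctionals posᶠ positions r i j r′ i′ j′ e e′
    (trans (pos-values r i j) (trans (cong coords p) (sym (pos-values r′ i′ j′))))

  Proper : Chart → ℕ → ℕ → Set
  Proper (k , π , later) i j = Ready (phase later) (span k π) i j

  hexIn : Chart → ℕ → ℕ → ℕ × ℕ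
  hexIn (k , π , later) i j = hexAt k π (iAt (phase later) (span k π) i j) (jAt (phase later) (span k π) i j)

  codeAt : Region × Mode → ℕ → ℕ → Code
  codeAt (r , m) i j = r , iAt m (extent r) i j , jAt m (extent r) i j

  -- A short piece has length 0, which is no successor. Hence `allCharts` may skip its later charts.
  proper-long : ∀ k π later i j → Proper (k , π , later) i j → T later → T (long π)
  proper-long k π true i j e _ = go (long π) e
    where
    go : ∀ l → suc (i + j) ≡ len (if l then just (axis k (chain π)) else nothing) → T l
    go true _ = tt

  private
    admissible-sound : ∀ later m s s′ i j → T (admissible later m s s′) → Ready (phase later) s′ i j → Ready m s i j
    admissible-sound later start s s′ i j t ok = tt
    admissible-sound later end   s s′ i j t ok = tt
    admissible-sound true  fore  s s′ i j t ok = subst (λ s → suc (i + j) ≡ len s) (sym (==ˢ-sound s s′ t)) ok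
    admissible-sound true  back  s s′ i j t ok = subst (λ s → suc (i + j) ≡ len s) (sym (==ˢ-sound s s′ t)) ok

    hexAtlas-sound : ∀ χ i j → Proper χ i j → (⟦ proj₁ (hexAtlas χ) ⟧ i j , ⟦ proj₂ (hexAtlas χ) ⟧ i j) ≡ hexIn χ i j
    hexAtlas-sound (k , π , later) i j ok = cong₂ _,_
      (inst-sound (phase later) (span k π) (proj₁ (hexᶠ k π)) i j ok)
      (inst-sound (phase later) (span k π) (proj₂ (hexᶠ k π)) i j ok)

    -- Passes from equal coefficients to equal coordinates, and from these to equal lattice
    -- vertices.
    fits-sound : ∀ χ t slot i j → T (fits χ t slot) → Proper χ i j →
      Ready (proj₂ slot) (extent (proj₁ slot)) i j ×
      posAt (codeAt slot i j) ≡ cornerAt (spin (proj₁ χ) t) (hexIn χ i j)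
    fits-sound χ@(k , π , later) t (r , m) i j f ok
      with (adm , eqs) ← to (T-∧ {admissible later m (extent r) (span k π)}) f =
      ready , coords-injective _ _ (begin
        coords (posAt (codeAt (r , m) i j))
          ≡⟨ pos-values r (iAt m (extent r) i j) (jAt m (extent r) i j) ⟨
        values (posᶠ r) (iAt m (extent r) i j) (jAt m (extent r) i j)
          ≡⟨ inst-values m (extent r) (posᶠ r) i j ready ⟨
        values (Vec.map (inst m (extent r)) (posᶠ r)) i j
          ≡⟨ all≡ᶠ-sound (Vec.map (inst m (extent r)) (posᶠ r)) (cornerᶠ (spin k t) (hexAtlas χ)) i j eqs ⟩
        values (cornerᶠ (spin k t) (hexAtlas χ)) i j
          ≡⟨ cornerᶠ-values (spin k t) (proj₁ (hexAtlas χ)) (proj₂ (hexAtlas χ)) i j ⟩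
        coords (cornerAt (spin k t) (⟦ proj₁ (hexAtlas χ) ⟧ i j , ⟦ proj₂ (hexAtlas χ) ⟧ i j))
          ≡⟨ cong (λ h → coords (cornerAt (spin k t) h)) (hexAtlas-sound χ i j ok) ⟩
        coords (cornerAt (spin k t) (hexIn χ i j)) ∎)
      where
      open ≡-Reasoning
      ready : Ready m (extent r) i j
      ready = admissible-sound later m (extent r) (span k π) i j adm ok

    slot-fits : ∀ χ t i j → Proper χ i j → T (fits χ t (slotOf χ t))
    slot-fits χ@(k , π , later) t i j ok = all-∈ (λ t → fits χ t (slotOf χ t)) {allFin 6}
      (to T-≡ (allCharts-sound wellPlaced atlas k π later (proper-long k π later i j ok))) (∈-allFin t)

  slot-ready : ∀ χ t i j → Proper χ i j → Ready (proj₂ (slotOf χ t)) (extent (proj₁ (slotOf χ t))) i j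
  slot-ready χ t i j ok = proj₁ (fits-sound χ t (slotOf χ t) i j (slot-fits χ t i j ok) ok)

  slot-pos : ∀ χ t i j → Proper χ i j →
    posAt (codeAt (slotOf χ t) i j) ≡ cornerAt (spin (proj₁ χ) t) (hexIn χ i j)
  slot-pos χ t i j ok = proj₂ (fits-sound χ t (slotOf χ t) i j (slot-fits χ t i j ok) ok)

  codeAt-valid : ∀ r m i j → Ready m (extent r) i j → Valid (codeAt (r , m) i j)
  codeAt-valid r m i j = At-sum m (extent r) i j

  slot-valid : ∀ χ t i j → Proper χ i j → Valid (codeAt (slotOf χ t) i j)
  slot-valid χ t i j ok = codeAt-valid (proj₁ (slotOf χ t)) (proj₂ (slotOf χ t)) i j (slot-ready χ t i j ok)

  chartOf : ∀ k π i j → i + j ≡ len (span k π) →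
    ∃[ later ] ∃[ i′ ] ∃[ j′ ] (Proper (k , π , later) i′ j′ × hexIn (k , π , later) i′ j′ ≡ hexAt k π i j)
  chartOf k π zero    j e = false , 0 , 0 , tt , cong (hexAt k π 0) (sym e)
  chartOf k π (suc i) j e = true , i , j , e , refl

  hexIn-present : ∀ χ i j → Proper χ i j → Hexagon (proj₁ (hexIn χ i j)) (proj₂ (hexIn χ i j))
  hexIn-present (k , π , later) i j ok = hexAt-present k π
    (iAt (phase later) (span k π) i j) (jAt (phase later) (span k π) i j)
    (At-sum (phase later) (span k π) i j ok)

-- Distances

module Walks (G : Graph) where

  open Graph G

  snoc : ∀ {x y z n} → Walk G x y n → Adj y z → Walk G x z (suc n)
  snoc []      e = e ∷ []
  snoc (d ∷ w) e = d ∷ snoc w e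

  dist-unique : ∀ {x y m n} → Dist G x y m → Dist G x y n → m ≡ n
  dist-unique (w , least) (w′ , least′) = ≤-antisym (least _ w′) (least′ _ w)

  module _ (adj-sym : ∀ {x y} → Adj x y → Adj y x) where

    reverse : ∀ {x y n} → Walk G x y n → Walk G y x n
    reverse []      = []
    reverse (e ∷ w) = snoc (reverse w) (adj-sym e)

    dist-sym : ∀ {x y n} → Dist G x y n → Dist G y x n
    dist-sym (w , least) = reverse w , λ m w′ → least m (reverse w′)

    module _ (o : V) (f : V → ℕ) (f-o : f o ≡ 0)
             (lipschitz : ∀ {x y} → Adj x y → f y ≤ suc (f x))
             (descent : ∀ x → x ≡ o ⊎ ∃[ y ] (Adj y x × suc (f y) ≤ f x)) where

      private
        below : ∀ {x y n} → Walk G x y n → f y ≤ f x + n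
        below {x} []  = ≤-reflexive (sym (+-identityʳ (f x)))
        below {x} {y} {suc n} (e ∷ w) =
          ≤-trans (below w) (≤-trans (+-monoˡ-≤ n (lipschitz e)) (≤-reflexive (sym (+-suc (f x) n))))

        reach : ∀ n x → f x ≡ n → Walk G o x n
        reach n x e with descent x
        reach n       x e | inj₁ refl with refl ← trans (sym f-o) e = []
        reach zero    x e | inj₂ (y , adj , lt) = ⊥-elim (n≮0 (≤-trans lt (≤-reflexive e)))
        reach (suc n) x e | inj₂ (y , adj , lt) =
          -- The step lowers f by at least 1, and by the Lipschitz condition by at most 1, so the
          -- walk gets length exactly f x.
          snoc (reach n y (suc-injective (trans (≤-antisym lt (lipschitz adj)) e))) adj

      -- The Lipschitz condition bounds the length of every walk from below; following the descent
      -- yields a walk attaining the bound.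
      potential-dist : ∀ x → Dist G o x (f x)
      potential-dist x = reach (f x) x refl , λ m w → ≤-trans (below w) (≤-reflexive (cong (_+ m) f-o))

module Distances (a b c : ℕ) where

  open Atlas a b c public

  G : Graph
  G = FCS A B C

  open Graph G public
  open Walks G public

  adj-sym : ∀ {x y : V} → Adj x y → Adj y x
  adj-sym {x} {y} = edge-sym (proj₁ x) (proj₁ y)

  vertex-≡ : ∀ {x y : V} → proj₁ x ≡ proj₁ y → x ≡ y
  vertex-≡ {v , t} {.v , t′} refl = cong (v ,_) (T-irrelevant t t′)

  vertex : ∀ u → Valid u → V
  vertex u@(r , i , j) e = posAt u , corner-vertex (spin (proj₁ r) (homeCorner r)) (proj₁ h) (proj₂ h)
    (hexAt-present (proj₁ r) (homePiece r) i j e)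
    where
    h = hexAt (proj₁ r) (homePiece r) i j

  private
    -- Both ends of a side are read in one chart with the same i and j; only then can their forms be
    -- compared by coefficients.
    InChart : ℕ → ℕ → Fin 6 → Set
    InChart q r t = ∃[ χ ] ∃[ u ] ∃[ i ] ∃[ j ] (Proper χ i j ×
      cornerAt t (q , r) ≡ posAt (codeAt (slotOf χ u) i j) ×
      cornerAt (next t) (q , r) ≡ posAt (codeAt (slotOf χ (next u)) i j))

    abstract
      inChart : ∀ q r t → Hexagon q r → InChart q r t
      inChart q r t h = coded (hexCode q r h)
        where
        charted : ∀ k π → ∃[ later ] ∃[ i ] ∃[ j ] (Proper (k , π , later) i j × hexIn (k , π , later) i j ≡ (q , r)) → InChart q r t
        charted k π (later , i , j , ok , h≡) = χ , u , i , j , ok ,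
          trans (cong₂ cornerAt (sym spin≡) (sym h≡)) (sym (slot-pos χ u i j ok)) ,
          trans (cong₂ cornerAt (trans (cong next (sym spin≡)) (sym (spin-next k u))) (sym h≡)) (sym (slot-pos χ (next u) i j ok))
          where
          χ : Chart
          χ = k , π , later
          u : Fin 6
          u = spin (opposite k) t
          spin≡ : spin k u ≡ t
          spin≡ = spin-opposite k t
        coded : HexCode q r → InChart q r t
        coded (k , π , i , j , e , q≡) = charted k π (subst (λ h → ∃[ later ] ∃[ i ] ∃[ j ]
          (Proper (k , π , later) i j × hexIn (k , π , later) i j ≡ h)) (sym q≡) (chartOf k π i j e))

  abstract
    encode : ∀ (x : V) → ∃[ u ] (Valid u × posAt u ≡ proj₁ x)
    encode (v , t) = onCorner (vertex-corner v t)
      where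
      onChart : ∀ {q r τ} → v ≡ cornerAt τ (q , r) → InChart q r τ → ∃[ u ] (Valid u × posAt u ≡ v)
      onChart v≡ (χ , u , i , j , ok , p , _) = codeAt (slotOf χ u) i j , slot-valid χ u i j ok , sym (trans v≡ p)
      onCorner : OnCorner v → ∃[ u ] (Valid u × posAt u ≡ v)
      onCorner (q , r , τ , h , v≡) = onChart v≡ (inChart q r τ h)

  code : V → Code
  code x = proj₁ (encode x)

  code-valid : ∀ x → Valid (code x)
  code-valid x = proj₁ (proj₂ (encode x))

  pos-code : ∀ x → posAt (code x) ≡ proj₁ x
  pos-code x = proj₂ (proj₂ (encode x))

  code-unique : ∀ x u → Valid u → posAt u ≡ proj₁ x → code x ≡ u
  code-unique x u e p = pos-injective (code x) u (code-valid x) e (trans (pos-code x) (sym p))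

  code-injective : ∀ x y → code x ≡ code y → x ≡ y
  code-injective x y e = vertex-≡ (trans (sym (pos-code x)) (trans (cong posAt e) (pos-code y)))

  weigh : (Region → Form) → Code → ℕ
  weigh f (r , i , j) = ⟦ f r ⟧ i j

  private
    weigh-slot : ∀ f slot i j → Ready (proj₂ slot) (extent (proj₁ slot)) i j →
      ⟦ valueAt f slot ⟧ i j ≡ weigh f (codeAt slot i j)
    weigh-slot f (r , m) i j = inst-sound m (extent r) (f r) i j

    weigh-≤ : ∀ f slot slot′ i j → T (valueAt f slot ≤ᶠ num 1 ⊞ valueAt f slot′) →
      Ready (proj₂ slot) (extent (proj₁ slot)) i j → Ready (proj₂ slot′) (extent (proj₁ slot′)) i j →
      weigh f (codeAt slot i j) ≤ suc (weigh f (codeAt slot′ i j))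
    weigh-≤ f slot slot′ i j t ok ok′ = begin
      weigh f (codeAt slot i j)            ≡⟨ weigh-slot f slot i j ok ⟨
      ⟦ valueAt f slot ⟧ i j               ≤⟨ ≤ᶠ-sound (valueAt f slot) (num 1 ⊞ valueAt f slot′) i j t ⟩
      ⟦ num 1 ⊞ valueAt f slot′ ⟧ i j      ≡⟨ ⟦⊞⟧ (num 1) (valueAt f slot′) i j ⟩
      ⟦ num 1 ⟧ i j + ⟦ valueAt f slot′ ⟧ i j ≡⟨ cong₂ _+_ (⟦num⟧ 1 i j) (weigh-slot f slot′ i j ok′) ⟩
      suc (weigh f (codeAt slot′ i j))     ∎
      where open ≤-Reasoning

    weigh-< : ∀ f slot slot′ i j → T (num 1 ⊞ valueAt f slot′ ≤ᶠ valueAt f slot) →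
      Ready (proj₂ slot) (extent (proj₁ slot)) i j → Ready (proj₂ slot′) (extent (proj₁ slot′)) i j →
      suc (weigh f (codeAt slot′ i j)) ≤ weigh f (codeAt slot i j)
    weigh-< f slot slot′ i j t ok ok′ = begin
      suc (weigh f (codeAt slot′ i j))     ≡⟨ cong₂ _+_ (⟦num⟧ 1 i j) (weigh-slot f slot′ i j ok′) ⟨
      ⟦ num 1 ⟧ i j + ⟦ valueAt f slot′ ⟧ i j ≡⟨ ⟦⊞⟧ (num 1) (valueAt f slot′) i j ⟨
      ⟦ num 1 ⊞ valueAt f slot′ ⟧ i j      ≤⟨ ≤ᶠ-sound (num 1 ⊞ valueAt f slot′) (valueAt f slot) i j t ⟩
      ⟦ valueAt f slot ⟧ i j               ≡⟨ weigh-slot f slot i j ok ⟩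
      weigh f (codeAt slot i j)            ∎
      where open ≤-Reasoning

  -- Every edge is a side of some hexagon, hence visible in a chart. The numbering of corners may
  -- run along it or against it, and `near` bounds the change both ways.
  gentle-lipschitz : ∀ f → allCharts (gentle f) ≡ true → ∀ {x y} → Adj x y → weigh f (code y) ≤ suc (weigh f (code x))
  gentle-lipschitz f t {x} {y} adj = [ along , against ]′ (edge-side (proj₁ x) (proj₁ y) adj)
    where
    close : ∀ χ u i j → Proper χ i j → T (near (valueAt f (slotOf χ u)) (valueAt f (slotOf χ (next u))))
    close χ@(k , π , later) u i j ok = cyclic-sound near (λ t → valueAt f (slotOf χ t))
      (allCharts-sound (gentle f) t k π later (proper-long k π later i j ok)) u

    along : OnSide (proj₁ x) (proj₁ y) → weigh f (code y) ≤ suc (weigh f (code x))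
    along (q , r , τ , h , x≡ , y≡) = go (inChart q r τ h)
      where
      go : InChart q r τ → weigh f (code y) ≤ suc (weigh f (code x))
      go (χ , u , i , j , ok , p , p′) = subst₂ (λ c c′ → weigh f c ≤ suc (weigh f c′))
        (sym (code-unique y _ (slot-valid χ (next u) i j ok) (sym (trans y≡ p′))))
        (sym (code-unique x _ (slot-valid χ u i j ok) (sym (trans x≡ p))))
        (weigh-≤ f (slotOf χ (next u)) (slotOf χ u) i j
          (proj₂ (to (T-∧ {valueAt f (slotOf χ u) ≤ᶠ num 1 ⊞ valueAt f (slotOf χ (next u))}) (close χ u i j ok)))
          (slot-ready χ (next u) i j ok) (slot-ready χ u i j ok))

    against : OnSide (proj₁ y) (proj₁ x) → weigh f (code y) ≤ suc (weigh f (code x))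
    against (q , r , τ , h , y≡ , x≡) = go (inChart q r τ h)
      where
      go : InChart q r τ → weigh f (code y) ≤ suc (weigh f (code x))
      go (χ , u , i , j , ok , p , p′) = subst₂ (λ c c′ → weigh f c ≤ suc (weigh f c′))
        (sym (code-unique y _ (slot-valid χ u i j ok) (sym (trans y≡ p))))
        (sym (code-unique x _ (slot-valid χ (next u) i j ok) (sym (trans x≡ p′))))
        (weigh-≤ f (slotOf χ u) (slotOf χ (next u)) i j
          (proj₁ (to (T-∧ {valueAt f (slotOf χ u) ≤ᶠ num 1 ⊞ valueAt f (slotOf χ (next u))}) (close χ u i j ok)))
          (slot-ready χ u i j ok) (slot-ready χ (next u) i j ok))

  private
    slot-adj : ∀ χ u i j → Proper χ i j → ∀ x y → proj₁ x ≡ posAt (codeAt (slotOf χ u) i j) →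
      proj₁ y ≡ posAt (codeAt (slotOf χ (next u)) i j) → Adj x y
    slot-adj χ u i j ok x y x≡ y≡ = subst₂ (λ v w → T (isEdge A B C v w))
      (sym (trans x≡ (slot-pos χ u i j ok)))
      (sym (trans y≡ (trans (slot-pos χ (next u) i j ok) (cong (λ t → cornerAt t (hexIn χ i j)) (spin-next (proj₁ χ) u)))))
      (corner-edge (spin (proj₁ χ) u) (proj₁ (hexIn χ i j)) (proj₂ (hexIn χ i j)) (hexIn-present χ i j ok))

    Lower : (Region → Form) → V → Set
    Lower f x = ∃[ y ] (Adj y x × suc (weigh f (code y)) ≤ weigh f (code x))

    sink : ∀ f χ u m r i j → Proper χ i j → slotOf χ u ≡ (r , m) → T (sinks f r χ u m) →
      ∀ x → code x ≡ codeAt (r , m) i j → Lower f x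
    sink f χ u m r i j ok refl t x x≡ = [ forwards , backwards ]′
      (to (T-∨ {num 1 ⊞ valueAt f (slotOf χ (next u)) ≤ᶠ inst m (extent r) (f r)}) t)
      where
      at : ∀ v → V
      at v = vertex (codeAt (slotOf χ v) i j) (slot-valid χ v i j ok)
      x-pos : proj₁ x ≡ posAt (codeAt (slotOf χ u) i j)
      x-pos = trans (sym (pos-code x)) (cong posAt x≡)
      at-code : ∀ v → code (at v) ≡ codeAt (slotOf χ v) i j
      at-code v = code-unique (at v) _ (slot-valid χ v i j ok) refl
      lower : ∀ v → T (num 1 ⊞ valueAt f (slotOf χ v) ≤ᶠ valueAt f (slotOf χ u)) →
        suc (weigh f (code (at v))) ≤ weigh f (code x)
      lower v t = subst₂ (λ c c′ → suc (weigh f c) ≤ weigh f c′) (sym (at-code v)) (sym x≡)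
        (weigh-< f (slotOf χ u) (slotOf χ v) i j t (slot-ready χ u i j ok) (slot-ready χ v i j ok))
      forwards : T (num 1 ⊞ valueAt f (slotOf χ (next u)) ≤ᶠ valueAt f (slotOf χ u)) → Lower f x
      forwards t = at (next u) , adj-sym {x} {at (next u)} (slot-adj χ u i j ok x (at (next u)) x-pos refl) , lower (next u) t
      backwards : T (num 1 ⊞ valueAt f (slotOf χ (prev u)) ≤ᶠ valueAt f (slotOf χ u)) → Lower f x
      backwards t = at (prev u) ,
        slot-adj χ (prev u) i j ok (at (prev u)) x refl
          -- `prev` is five steps forward, so `next (prev u)` is a full turn.
          (trans x-pos (cong (λ v → posAt (codeAt (slotOf χ v) i j)) (sym (next⁶ u)))) ,
        lower (prev u) t

  private
    does-sound : ∀ {P : Set} (d : Dec P) → T (does d) → P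
    does-sound (yes p) _ = p

    if-true : ∀ {x} l y → T l → T (if l then x else y) → T x
    if-true true y _ t = t

    if-false : ∀ {y} l x → (T l → ⊥) → T (if l then x else y) → T y
    if-false true  x ¬l t = ⊥-elim (¬l tt)
    if-false false x ¬l t = t

    extent-long : ∀ r n → suc n ≡ len (extent r) → T (long (homePiece r))
    extent-long r n e = go (long (homePiece r)) e
      where
      go : ∀ l → suc n ≡ len (if l then just (axis (proj₁ r) (chain (homePiece r))) else nothing) → T l
      go true _ = tt

    -- The vertex with i = 0 is read on the first hexagon, the others on later ones. There the chart
    -- variables sum to one less than the length of π, so π must have the span of the region.
    start-sound : ∀ f r π t → T (startCover (occupies r) r π t) → T (startCover (sinks f r) r π t) →
      (T (long (homePiece r)) → span (proj₁ r) π ≡ extent r) →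
      ∀ i j → Valid (r , i , j) → ∀ x → code x ≡ (r , i , j) → Lower f x
    start-sound f r@(k , _) π t occ snk same zero j e x x≡ =
      sink f (k , π , false) t start r 0 0 tt
        (does-sound (slotOf (k , π , false) t ≟ˢ (r , start)) (proj₁ (to T-∧ occ))) (proj₁ (to T-∧ snk))
        x (trans x≡ (cong (λ l → r , 0 , l) e))
    start-sound f r@(k , _) π t occ snk same (suc i) j e x x≡ =
      sink f (k , π , true) t fore r i j (trans e (cong len (sym (same l))))
        (does-sound (slotOf (k , π , true) t ≟ˢ (r , fore))
          (later {occupies r (k , π , true) t fore} (proj₂ (to (T-∧ {occupies r (k , π , false) t start}) occ))))
        (later {sinks f r (k , π , true) t fore} (proj₂ (to (T-∧ {sinks f r (k , π , false) t start}) snk))) x x≡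
      where
      l : T (long (homePiece r))
      l = extent-long r (i + j) e
      later : ∀ {p} → T (not (long (homePiece r)) ∨ p) → T p
      later t = [ (λ n → ⊥-elim (T-not-elim n l)) , (λ t → t) ]′ (to (T-∨ {not (long (homePiece r))}) t)

    -- The last vertex, j = 0, lies on the hexagon behind the long piece; the others lie on the next
    -- hexagon of the piece itself, as its `back` corners.
    end-sound : ∀ f r π t → T (endCover (occupies r) r π t) → T (endCover (sinks f r) r π t) →
      ∀ i j → Valid (r , i , j) → ∀ x → code x ≡ (r , i , j) → Lower f x
    end-sound f r@(k , _) π t occ snk i zero e x x≡ =
      sink f (k , π , false) t end r 0 0 tt
        (does-sound (slotOf (k , π , false) t ≟ˢ (r , end)) (proj₁ (to (T-∧ {occupies r (k , π , false) t end}) occ)))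
        (proj₁ (to (T-∧ {sinks f r (k , π , false) t end}) snk)) x
        (trans x≡ (cong (λ l → r , l , 0) (trans (sym (+-identityʳ i)) e)))
    end-sound f r@(k , _) π t occ snk i (suc j) e x x≡ =
      sink f (k , homePiece r , true) t back r i j (trans (sym (+-suc i j)) e)
        (does-sound (slotOf (k , homePiece r , true) t ≟ˢ (r , back)) (proj₂ (to (T-∧ {occupies r (k , π , false) t end}) occ)))
        (proj₂ (to (T-∧ {sinks f r (k , π , false) t end}) snk)) x x≡

    beyond-sound : ∀ f r face → T (is-nothing face ∨ beyondCover (occupies r) r face) → T (beyondCover (sinks f r) r face) →
      ∀ i j → Valid (r , i , j) → ∀ x → code x ≡ (r , i , j) → Lower f x
    beyond-sound f r (just (π , t)) occ snk i j e x x≡ = go (T? (long (homePiece r)))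
      where
      go : Dec (T (long (homePiece r))) → Lower f x
      go (yes l) = end-sound f r π t
        (if-true (long (homePiece r)) (startCover (occupies r) r π t) l occ)
        (if-true (long (homePiece r)) (startCover (sinks f r) r π t) l snk) i j e x x≡
      go (no ¬l) = start-sound f r π t
        (if-false (long (homePiece r)) (endCover (occupies r) r π t) ¬l occ)
        (if-false (long (homePiece r)) (endCover (sinks f r) r π t) ¬l snk) (λ l → ⊥-elim (¬l l)) i j e x x≡

    region-covered : ∀ r → T (homeCover (occupies r) r) × T (is-nothing (beyond r) ∨ beyondCover (occupies r) r (beyond r))
    region-covered r = to (T-∧ {homeCover (occupies r) r}) (all-∈ covered {regions} coverage (∈-regions r))

  descends-sound : ∀ o f r → T (descends o f r) →
    ∀ i j → Valid (r , i , j) → ∀ x → code x ≡ (r , i , j) → r ≡ o ⊎ Lower f x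
  descends-sound o f r t i j e x x≡ =
    [ inj₁ ∘ does-sound (r ≟ʳ o)
    , inj₂ ∘ [ (λ t → start-sound f r (homePiece r) (homeCorner r) (proj₁ (region-covered r)) t (λ _ → refl) i j e x x≡)
             , (λ t → beyond-sound f r (beyond r) (proj₂ (region-covered r)) t i j e x x≡) ]′
           ∘ to (T-∨ {homeCover (sinks f r) r}) ]′
    (to (T-∨ {does (r ≟ʳ o)}) t)

  private
    ∈-sources : ∀ s → s ∈ sources
    ∈-sources (k , n) = ∈-cartesianProduct⁺ (∈-allFin k) (∈-allFin n)

    gentle-source : ∀ s → allCharts (gentle (distᶠ s)) ≡ true
    gentle-source s = all-true (λ s → allCharts (gentle (distᶠ s))) {sources} {s} gentleness (∈-sources s)

    descends-source : ∀ s r → T (descends (site s) (distᶠ s) r)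
    descends-source s r = all-∈ (descends (site s) (distᶠ s)) {regions} {r} (descends-all s) (∈-regions r)
      where
      descends-all : ∀ s → all (descends (site s) (distᶠ s)) regions ≡ true
      descends-all s = all-true (λ s → all (descends (site s) (distᶠ s)) regions) {sources} {s} descending (∈-sources s)

    nothing-len : ∀ s → T (is-nothing s) → 0 ≡ len s
    nothing-len nothing _ = refl

  siteCode : Source → Code
  siteCode s = site s , 0 , 0

  site-valid : ∀ s → Valid (siteCode s)
  site-valid s = nothing-len (extent (site s))
    (all-∈ (λ s → is-nothing (extent (site s))) {sources} {s} anchored (∈-sources s))

  source : Source → V
  source s = vertex (siteCode s) (site-valid s)

  code-source : ∀ s → code (source s) ≡ siteCode s
  code-source s = code-unique (source s) (siteCode s) (site-valid s) refl

  D : Source → V → ℕ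
  D s x = weigh (distᶠ s) (code x)

  D-source : ∀ s → D s (source s) ≡ 0
  D-source s = trans (cong (weigh (distᶠ s)) (code-source s))
    (≡ᶠ-sound (distᶠ s (site s)) (num 0) 0 0
      (all-∈ (λ s → distᶠ s (site s) ≡ᶠ num 0) {sources} {s} vanishing (∈-sources s)))

  D-dist : ∀ s x → Dist G (source s) x (D s x)
  D-dist s = potential-dist (λ {x} {y} → adj-sym {x} {y}) (source s) (D s) (D-source s)
    (λ {x} {y} → gentle-lipschitz (distᶠ s) (gentle-source s) {x} {y}) descent
    where
    -- `descends` exempts the whole region of the source, which is harmless because that region is a
    -- single vertex.
    at-site : ∀ x r i j → code x ≡ (r , i , j) → Valid (r , i , j) → r ≡ site s → x ≡ source s
    at-site x r i j x≡ e refl = code-injective x (source s) (trans x≡ (trans (cong (site s ,_)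
      (cong₂ _,_ (m+n≡0⇒m≡0 i sum) (m+n≡0⇒n≡0 i sum))) (sym (code-source s))))
      where
      sum : i + j ≡ 0
      sum = trans e (sym (site-valid s))
    descent : ∀ x → x ≡ source s ⊎ ∃[ y ] (Adj y x × suc (D s y) ≤ D s x)
    descent x = go (code x) refl (code-valid x)
      where
      go : ∀ u → code x ≡ u → Valid u → x ≡ source s ⊎ ∃[ y ] (Adj y x × suc (D s y) ≤ D s x)
      go (r , i , j) x≡ e = [ inj₁ ∘ at-site x r i j x≡ e , inj₂ ]′
        (descends-sound (site s) (distᶠ s) r (descends-source s r) i j e x x≡)

  -- The upper bound: three landmarks resolve everything

  tag : V → Bool
  tag x = proj₂ (proj₂ (proj₁ x))

  flips : ℕ → Bool → Bool
  flips zero    t = t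
  flips (suc n) t = flips n (not t)

  -- Every edge joins an up to a down triangle, so the graph is bipartite and the parity of a
  -- distance determines the colour.
  walk-tag : ∀ {x y n} → Walk G x y n → tag y ≡ flips n (tag x)
  walk-tag []      = refl
  walk-tag {x} {n = suc n} (_∷_ {y = y} e w) = trans (walk-tag w) (cong (flips n) (edge-tag (proj₁ x) (proj₁ y) e))
    where
    edge-tag : ∀ u v → T (isEdge A B C u v) → proj₂ (proj₂ v) ≡ not (proj₂ (proj₂ u))
    edge-tag (_ , _ , true)  (_ , _ , false) _ = refl
    edge-tag (_ , _ , false) (_ , _ , true)  _ = refl

  landmarks-resolve : ∀ x y → (∀ k → D (landmark k) x ≡ D (landmark k) y) → x ≡ y
  landmarks-resolve x y eq = code-injective x y (go (code x) (code y) refl refl)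
    where
    tags : tag x ≡ tag y
    -- Equal distance to one landmark already forces equal colour, so adding the colour to the
    -- distances assumes nothing new.
    tags = trans (walk-tag (proj₁ (D-dist (landmark 0F) x)))
      (trans (cong (λ n → flips n (tag (source (landmark 0F)))) (eq 0F)) (sym (walk-tag (proj₁ (D-dist (landmark 0F) y)))))

    tag-value : ∀ z r i j → code z ≡ (r , i , j) → ⟦ lookup (posᶠ r) 2F ⟧ i j ≡ (if tag z then 1 else 0)
    tag-value z r i j z≡ = trans (sym (lookup-map 2F (λ F → ⟦ F ⟧ i j) (posᶠ r)))
      (trans (cong (λ v → lookup v 2F) (pos-values r i j))
      (cong (λ v → lookup (coords v) 2F) (trans (cong posAt (sym z≡)) (pos-code z))))

    go : ∀ u v → code x ≡ u → code y ≡ v → code x ≡ code y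
    go (r , i , j) (r′ , i′ , j′) x≡ y≡ = trans x≡ (trans
      (injective landmarkFunctionals landmarkᶠ landmarks r i j r′ i′ j′
        (subst Valid x≡ (code-valid x)) (subst Valid y≡ (code-valid y))
        (cong₂ _∷_ (trans (tag-value x r i j x≡) (trans (cong (if_then 1 else 0) tags) (sym (tag-value y r′ i′ j′ y≡))))
        (cong₂ _∷_ (values-eq 0F) (cong₂ _∷_ (values-eq 1F) (cong₂ _∷_ (values-eq 2F) refl))))) (sym y≡))
      where
      values-eq : ∀ k → ⟦ distᶠ (landmark k) r ⟧ i j ≡ ⟦ distᶠ (landmark k) r′ ⟧ i′ j′
      values-eq k = trans (cong (weigh (distᶠ (landmark k))) (sym x≡)) (trans (eq k) (cong (weigh (distᶠ (landmark k))) y≡))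

  basis : List V
  basis = source (landmark 0F) ∷ source (landmark 1F) ∷ source (landmark 2F) ∷ []

  basis-unique : Unique basis
  basis-unique = (apart-by 0F 1F (λ ()) ∷ apart-by 0F 2F (λ ()) ∷ []) ∷ (apart-by 1F 2F (λ ()) ∷ []) ∷ [] ∷ []
    where
    apart-by : ∀ k k′ → k ≢ k′ → source (landmark k) ≢ source (landmark k′)
    apart-by k k′ ne e = ne (cong (λ u → proj₁ (proj₁ u))
      (trans (sym (code-source (landmark k))) (trans (cong code e) (code-source (landmark k′)))))

  basis-generates : IsMetricGenerator G basis
  basis-generates β γ β≢γ = go (same? 0F) (same? 1F) (same? 2F)
    where
    Same : Sector → Set
    Same k = D (landmark k) β ≡ D (landmark k) γ
    same? : ∀ k → Dec (Same k)
    same? k = D (landmark k) β ≟ D (landmark k) γ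
    resolve : ∀ k → source (landmark k) ∈ basis → ¬ Same k → ∃[ α ] (α ∈ basis × Resolves G α β γ)
    resolve k k∈ ne = source (landmark k) , k∈ , _ , _ , D-dist (landmark k) β , D-dist (landmark k) γ , ne
    go : Dec (Same 0F) → Dec (Same 1F) → Dec (Same 2F) → ∃[ α ] (α ∈ basis × Resolves G α β γ)
    go (no ne)  _        _        = resolve 0F (here refl) ne
    go (yes _)  (no ne)  _        = resolve 1F (there (here refl)) ne
    go (yes _)  (yes _)  (no ne)  = resolve 2F (there (there (here refl))) ne
    go (yes e₀) (yes e₁) (yes e₂) = ⊥-elim (β≢γ (landmarks-resolve β γ λ { 0F → e₀ ; 1F → e₁ ; 2F → e₂ }))

  -- The lower bound: two vertices never suffice

  private
    meet-sound : ∀ {X : Set} (f g : X → Bool) xs → T (meet (map f xs) (map g xs)) → ∃[ x ] (x ∈ xs × T (f x) × T (g x))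
    meet-sound f g (x ∷ xs) t with to (T-∨ {f x ∧ g x}) t
    ... | inj₁ t = x , here refl , to T-∧ t
    ... | inj₂ t with (y , y∈ , p) ← meet-sound f g xs t = y , there y∈ , p

    common-twins : ∀ r r′ → ∃[ p ] (p ∈ twins × T (confused r p) × T (confused r′ p))
    common-twins r r′ = meet-sound (confused r) (confused r′) twins
      (allPairs-∈ meet {map signature regions} {signature r} {signature r′} twins-meet
        (∈-map⁺ signature {xs = regions} (∈-regions r)) (∈-map⁺ signature {xs = regions} (∈-regions r′)))

    const≤ : ∀ F i j → const F ≤ ⟦ F ⟧ i j
    const≤ (form k x y z m n) i j = ≤-trans (m≤m+n k (x * a)) (≤-trans (m≤m+n _ (y * b)) (≤-trans (m≤m+n _ (z * c))
      (≤-trans (m≤m+n _ (m * i)) (m≤m+n _ (n * j)))))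

  distinct-sound : ∀ s s′ → T (distinct (s , s′)) → source s ≢ source s′
  distinct-sound s s′ t e = n≮0 (≤-trans (≤ᵇ⇒≤ 1 _ t) (≤-trans (const≤ (distᶠ s (site s′)) 0 0)
    (≤-reflexive (trans (cong (weigh (distᶠ s)) (sym (code-source s′))) (trans (cong (D s) (sym e)) (D-source s))))))

  -- The forms measure from the twins, resolving measures from x; symmetry and uniqueness of
  -- distance identify the two.
  confused-sound : ∀ s s′ x → T (confused (proj₁ (code x)) (s , s′)) → ¬ Resolves G x (source s) (source s′)
  confused-sound s s′ x t (k₁ , k₂ , d₁ , d₂ , ne) = ne (begin
    k₁      ≡⟨ dist-unique (dist-sym (λ {x} {y} → adj-sym {x} {y}) d₁) (D-dist s x) ⟩
    D s x   ≡⟨ ≡ᶠ-sound (distᶠ s (proj₁ (code x))) (distᶠ s′ (proj₁ (code x)))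
                 (proj₁ (proj₂ (code x))) (proj₂ (proj₂ (code x))) t ⟩
    D s′ x  ≡⟨ dist-unique (dist-sym (λ {x} {y} → adj-sym {x} {y}) d₂) (D-dist s′ x) ⟨
    k₂      ∎)
    where open ≡-Reasoning

  unresolved-twins : ∀ x y → ∃[ β ] ∃[ γ ] (β ≢ γ × ¬ Resolves G x β γ × ¬ Resolves G y β γ)
  unresolved-twins x y = go (common-twins (proj₁ (code x)) (proj₁ (code y)))
    where
    go : ∃[ p ] (p ∈ twins × T (confused (proj₁ (code x)) p) × T (confused (proj₁ (code y)) p)) →
      ∃[ β ] ∃[ γ ] (β ≢ γ × ¬ Resolves G x β γ × ¬ Resolves G y β γ)
    go ((s , s′) , p∈ , cx , cy) = source s , source s′ ,
      distinct-sound s s′ (all-∈ distinct {twins} twins-distinct p∈) , confused-sound s s′ x cx , confused-sound s s′ y cy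

  -- As x and y may coincide and need not occur in U, this settles lists of length 0, 1 and 2
  -- together.
  two-not-enough : ∀ x y U → (∀ {z} → z ∈ U → z ≡ x ⊎ z ≡ y) → ¬ IsMetricGenerator G U
  two-not-enough x y U within gen = go (unresolved-twins x y)
    where
    go : ¬ (∃[ β ] ∃[ γ ] (β ≢ γ × ¬ Resolves G x β γ × ¬ Resolves G y β γ))
    go (β , γ , β≢γ , nx , ny) with (α , α∈ , res) ← gen β γ β≢γ with within α∈
    ... | inj₁ refl = nx res
    ... | inj₂ refl = ny res

  generator-size : ∀ U → IsMetricGenerator G U → 3 ≤ length U
  generator-size []               gen = ⊥-elim (two-not-enough o o [] (λ ()) gen)
    where
    o : V
    o = source (landmark 0F)
  generator-size (x ∷ [])         gen = ⊥-elim (two-not-enough x x _ (λ { (here e) → inj₁ e }) gen)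
  generator-size (x ∷ y ∷ [])     gen = ⊥-elim (two-not-enough x y _
    (λ { (here e) → inj₁ e ; (there (here e)) → inj₂ e }) gen)
  generator-size (x ∷ y ∷ z ∷ U) gen = s≤s (s≤s (s≤s z≤n))

theorem1 : (a b c : ℕ) → 4 ≤ a → 4 ≤ b → 4 ≤ c → HasMetricDimension (FCS a b c) 3
theorem1 _ _ _ (s≤s (s≤s (s≤s (s≤s (z≤n {a}))))) (s≤s (s≤s (s≤s (s≤s (z≤n {b}))))) (s≤s (s≤s (s≤s (s≤s (z≤n {c}))))) =
  (basis , basis-unique , refl , basis-generates) , λ U _ → generator-size U
  where open Distances a b c
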